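{- There is an absolute constant $\delta>0$ such that the online matroid intersection problem in the random arrival model admits a randomized online algorithm that is $\left(\frac12+\delta\right)$-competitive.
   Context: Online matroid intersection in the random arrival model: two matroids $\mathcal{M}_1=(E,\mathcal{I}_1)$ and $\mathcal{M}_2=(E,\mathcal{I}_2)$ are given on a common finite ground set $E$ with $m=|E|$. The elements of $E$ are revealed one at a time in a uniformly random order $\pi$. The algorithm knows $m$ and can query independence oracles of both matroids on sets of already-arrived elements. When an element arrives, the algorithm must immediately and irrevocably decide whether to pick it, and the set of picked elements must at all times be independent in both matroids. $\textsc{OPT}$ denotes a maximum-cardinality set independent in both matroids. An algorithm is $c$-competitive if on every instance the expected number of picked elements (expectation over the uniformly random order and the algorithm's internal coin tosses) is at least $c\,|\textsc{OPT}|$. -}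

module Defs where

open import Data.Bool.Base using (Bool; T; if_then_else_)
open import Data.Fin.Base using (Fin; zero; suc; punchIn)
open import Data.Fin.Permutation as Perm using (Permutation′; _≈_; _⟨$⟩ʳ_; insert; remove)
open import Data.Fin.Subset using (Subset; ⊥; ⁅_⁆; _∪_; _∈_; _∉_; _⊆_; ∣_∣)
open import Data.Integer.Base using (+_)
open import Data.Nat as ℕ using (ℕ; zero; suc; NonZero; _!)
open import Data.Nat.Properties using (_!≢0)
open import Data.Product.Base using (_×_; _,_; ∃-syntax)
open import Data.Rational using (ℚ; 0ℚ; _/_; _+_; _*_; _≤_)
open import Data.Vec.Base using (Vec; []; _∷_; map; concat; allFin; tabulate; foldr′)
open import Data.Vec.Membership.Propositional.Properties using (∈-allFin⁺)
open import Data.Vec.Relation.Unary.Any as Any using (Any; here)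
open import Data.Vec.Relation.Unary.Any.Properties using (map⁺; concat⁺)
open import Data.Vec.Relation.Unary.Unique.Propositional using (Unique)
open import Relation.Binary.PropositionalEquality using (refl; sym; trans; cong)

-- An independence oracle on a set of n elements.
Oracle : ℕ → Set
Oracle n = Subset n → Bool

record Matroid (n : ℕ) : Set where
  field
    oracle : Oracle n

  Independent : Subset n → Set
  Independent S = T (oracle S)

  field
    ⊥-independent : Independent ⊥
    hereditary    : ∀ {S U} → S ⊆ U → Independent U → Independent S
    exchange      : ∀ {S U} → Independent S → Independent U → ∣ S ∣ ℕ.< ∣ U ∣ →
                    ∃[ x ] x ∈ U × x ∉ S × Independent (⁅ x ⁆ ∪ S)

open Matroid public

CommonIndependent : ∀ {n} → Matroid n → Matroid n → Subset n → Set
CommonIndependent M₁ M₂ S = Independent M₁ S × Independent M₂ S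

IsOPT : ∀ {n} → Matroid n → Matroid n → Subset n → Set
IsOPT M₁ M₂ S =
  CommonIndependent M₁ M₂ S × (∀ U → CommonIndependent M₁ M₂ U → ∣ U ∣ ℕ.≤ ∣ S ∣)

-- The set of those entries of a vector whose positions lie in a given subset.
image : ∀ {m k} → Vec (Fin m) k → Subset k → Subset m
image []       []      = ⊥
image (e ∷ es) (b ∷ S) = if b then ⁅ e ⁆ ∪ image es S else image es S

-- The algorithm sees an element only through the time of its arrival: when k
-- elements have arrived, position zero denotes the latest arrival, position one
-- the arrival before that, and so on. Hence the oracles it is given answer
-- queries about sets of arrived elements only.
observed : ∀ {m k} → Matroid m → Vec (Fin m) k → Oracle k
observed M es S = oracle M (image es S)

-- The coin tosses are recorded by a seed, uniform on a finite set whose size may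
-- depend on the number m of elements. `decide` is called for each arrival, with
-- the restricted oracles and the set of elements picked before this arrival.
record RandomizedStrategy : Set where
  field
    seeds  : ℕ → ℕ
    decide : ∀ m → Fin (seeds m) → ∀ {k} →
             Oracle (suc k) → Oracle (suc k) → Subset k → Bool
    ⦃ seeds≢0 ⦄ : ∀ {m} → NonZero (seeds m)

  picked : ∀ {m k} → Matroid m → Matroid m → Fin (seeds m) →
           Vec (Fin m) k → Subset k
  picked M₁ M₂ r []       = []
  picked M₁ M₂ r (e ∷ es) =
    decide _ r (observed M₁ (e ∷ es)) (observed M₂ (e ∷ es)) previous ∷ previous
    where previous = picked M₁ M₂ r es

-- The repetition-free sequences are exactly the arrival histories that can occur
-- at some moment of the process, so `feasible` speaks about all times.
record OnlineAlgorithm : Set where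
  field
    strategy : RandomizedStrategy

  open RandomizedStrategy strategy public

  field
    feasible : ∀ {m k} (M₁ M₂ : Matroid m) (r : Fin (seeds m)) (es : Vec (Fin m) k) →
               Unique es → CommonIndependent M₁ M₂ (image es (picked M₁ M₂ r es))

permutations : ∀ n → Vec (Permutation′ n) (n !)
permutations zero    = Perm.id ∷ []
permutations (suc n) =
  concat (map (λ j → map (insert zero j) (permutations n)) (allFin (suc n)))

-- As there are n ! entries, every permutation is therefore listed exactly once.
permutations-complete : ∀ {n} (π : Permutation′ n) → Any (_≈ π) (permutations n)
permutations-complete {zero}  π = here λ ()
permutations-complete {suc n} π =
  concat⁺ (map⁺ (Any.map
    (λ { refl → map⁺ (Any.map extend (permutations-complete (remove zero π))) })
    (∈-allFin⁺ (π ⟨$⟩ʳ zero))))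
  where
  extend : ∀ {ρ : Permutation′ n} → ρ ≈ remove zero π →
           insert zero (π ⟨$⟩ʳ zero) ρ ≈ π
  extend {ρ} eq zero        = refl
  extend {ρ} eq (suc i) =
    trans (Perm.insert-punchIn zero (π ⟨$⟩ʳ zero) ρ i)
      (trans (cong (punchIn (π ⟨$⟩ʳ zero)) (eq i))
             (sym (Perm.punchIn-permute π zero i)))

mean : ∀ {n} .⦃ _ : NonZero n ⦄ → Vec ℚ n → ℚ
mean {n} xs = foldr′ _+_ 0ℚ xs * (+ 1 / n)

-- A permutation π encodes the order in which π ⟨$⟩ʳ zero arrives last and
-- π ⟨$⟩ʳ suc zero arrives second to last, up to the first arrival.
history : ∀ {m} → Permutation′ m → Vec (Fin m) m
history π = tabulate (π ⟨$⟩ʳ_)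

expectedSize : ∀ {m} → OnlineAlgorithm → Matroid m → Matroid m → ℚ
expectedSize {m} A M₁ M₂ =
  mean ⦃ m !≢0 ⦄ (map (λ π →
    mean (map (λ r → + ∣ picked M₁ M₂ r (history π) ∣ / 1) (allFin (seeds m))))
    (permutations m))
  where open OnlineAlgorithm A

_-competitive_ : ℚ → OnlineAlgorithm → Set
c -competitive A = ∀ {m} (M₁ M₂ : Matroid m) (OPT : Subset m) → IsOPT M₁ M₂ OPT →
  c * (+ ∣ OPT ∣ / 1) ≤ expectedSize A M₁ M₂

{-# OPTIONS --safe #-}

-- Let T be the greedy solution on the first eighth of the arrivals.  An optimal
-- element that arrives late and still fits T would have been picked by greedy, had
-- it arrived early, and by 2|greedy| ≥ |OPT| + |greedy ∩ OPT| this happens rarely if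
-- greedy is close to half optimal.  So then |T| is already about |OPT| / 2, and most
-- late optimal elements are blocked by T in exactly one of the two matroids, about
-- |T| of them in each.
--
-- Now keep only a uniformly random half of T, and search greedily for elements
-- blocked by T in the first matroid that fit the kept half there and all of T in the
-- second one; do the same with the matroids interchanged.  The two searches do not
-- interfere.  Tossing the coin of an element of T only when an arriving element could
-- replace it shows that each search finds about |T| / 3 elements, so the loss of
-- |T| / 2 is outweighed.  Mixing with plain greedy in the ratio 1 : 15 gives a lower
-- bound increasing in the expected size of greedy, which is at least |OPT| / 2.
module Submission where

open import Defs
import Data.Nat.Properties as ℕₚ
open import Algebra.Properties.Semiring.Sum ℕₚ.+-*-semiring
  using (sum; sum-cong-≗; sum-remove; ∑-comm; ∑-distrib-+; *-distribˡ-sum)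
open import Data.Bool.Base using (Bool; true; false; T; not; if_then_else_; _∧_)
open import Data.Bool.Properties using (T?; T-≡; T-∧; ∧-comm)
open import Data.Empty as Empty using (⊥-elim)
open import Data.Fin.Base using (Fin; zero; suc; punchIn)
open import Data.Fin.Permutation as Perm using (Permutation′; _⟨$⟩ʳ_; _⟨$⟩ˡ_)
open import Data.Fin.Properties using (_≟_; any?; punchInᵢ≢i; punchIn-injective)
open import Data.Fin.Subset
open import Data.Fin.Subset.Properties
import Data.Integer.Base as ℤ
import Data.Integer.Properties as ℤₚ
open import Data.List.Base using (List; []; _∷_; _∷ʳ_; foldl)
open import Data.List.Membership.DecPropositional using () renaming (_∈?_ to ∈ₗ?)
open import Data.List.Membership.Propositional using () renaming (_∈_ to _∈ₗ_)
open import Data.List.Membership.Propositional.Properties using (∈-++⁻; ∈-++⁺ˡ; ∈-++⁺ʳ)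
open import Data.List.Properties using (foldl-∷ʳ)
import Data.List.Relation.Unary.All as ListAll
open import Data.List.Relation.Unary.AllPairs as AllPairs using ([]; _∷_)
import Data.List.Relation.Unary.Any as ListAny
import Data.List.Relation.Unary.Unique.Propositional as ListUnique
import Data.List.Relation.Unary.Unique.Propositional.Properties as ListUnique
open import Data.Nat.Base
  using (ℕ; zero; suc; _+_; _*_; _∸_; _^_; _!; _≤_; _<_; z≤n; s≤s; _<ᵇ_; _≡ᵇ_; _/_; _%_; NonZero;
         ≢-nonZero)
open import Data.Nat.DivMod using (m/n*n≤m; m≡m%n+[m/n]*n; m%n<n; m/n<m)
open import Data.Nat.Properties hiding (_≟_)
open import Data.Nat.Tactic.RingSolver using (solve-∀)
open import Data.Product.Base using (_×_; _,_; ∃-syntax; Σ-syntax; proj₁; proj₂; map₂)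
open import Data.Rational as ℚ using (ℚ; 0ℚ; ½)
import Data.Rational.Properties as ℚₚ
open import Data.Rational.Unnormalised.Base as ℚᵘ using (mkℚᵘ; *≡*; *≤*)
import Data.Rational.Unnormalised.Properties as ℚᵘₚ
open import Data.Sum.Base as Sum using (_⊎_; inj₁; inj₂; [_,_]′)
open import Data.Vec.Base
  using (Vec; []; _∷_; head; lookup; tabulate; map; concat; allFin; _++_; foldr′; here; there; _[_]≔_)
  renaming (sum to vsum)
open import Data.Vec.Properties
  using (lookup∘tabulate; []=⇒lookup; lookup⇒[]=; lookup-map; map-∘; map-cong; map-++;
         map-lookup-allFin; sum-++; tabulate-∘; tabulate-allFin; tabulate-cong)
open import Data.Vec.Relation.Unary.All using (All)
import Data.Vec.Relation.Unary.All.Properties as All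
open import Data.Vec.Relation.Unary.Unique.Propositional using (Unique; []; _∷_)
open import Data.Vec.Relation.Unary.Unique.Propositional.Properties using (tabulate⁺; lookup-injective)
open import Function.Base using (_∘_; id)
open import Function.Bundles using (Equivalence)
open import Relation.Binary.PropositionalEquality
open import Relation.Nullary.Decidable
  using (Dec; yes; no; does; ¬?; _×-dec_; _⊎-dec_; _→-dec_; from-yes; dec-true; dec-false)
open import Relation.Nullary.Negation.Core using (¬_; contradiction)
open import Relation.Unary using (Pred; Decidable)

-- Subsets

-- A common independent set is usually improved by exchanges along augmenting paths, and irrevocable
-- picks rule these out: an element already taken cannot be swapped for a better one. So room is
-- made in advance, by discarding part of `T` before it is known which of its elements have
-- replacements. The length of the first phase is a compromise. If greedy is exactly half optimal
-- and `T` is formed from a fraction `f` of the arrivals, the marked algorithm gets at least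
-- `(7/2 - 2f)/6` of the optimum, which exceeds one half for `f < 1/4`. If greedy is better than
-- that, the bound on late optimal elements that still fit `T` costs a factor `1/f`, so `f` must not
-- be tiny either. Expectations are kept as sums of natural numbers over all orders and all coin
-- vectors; division occurs only at the very end.

ι : Bool → ℕ
ι b = if b then 1 else 0

∣∷∣ : ∀ {n} b (p : Subset n) → ∣ b ∷ p ∣ ≡ ι b + ∣ p ∣
∣∷∣ true  p = refl
∣∷∣ false p = refl

∈-insert : ∀ {n} (x : Fin n) (S : Subset n) → x ∈ ⁅ x ⁆ ∪ S
∈-insert x S = x∈p∪q⁺ (inj₁ (x∈⁅x⁆ x))

∪-⊆ : ∀ {n} {S U V : Subset n} → S ⊆ V → U ⊆ V → S ∪ U ⊆ V
∪-⊆ {S = S} {U} f g x∈ = [ f , g ]′ (x∈p∪q⁻ S U x∈)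

insert-⊆ : ∀ {n} {x : Fin n} {S U : Subset n} → x ∈ U → S ⊆ U → ⁅ x ⁆ ∪ S ⊆ U
insert-⊆ {x = x} x∈U = ∪-⊆ λ y∈ → subst (_∈ _) (sym (x∈⁅y⁆⇒x≡y x y∈)) x∈U

∪-mono : ∀ {n} {S S′ U U′ : Subset n} → S ⊆ S′ → U ⊆ U′ → S ∪ U ⊆ S′ ∪ U′
∪-mono {S′ = S′} {U′ = U′} f g = ∪-⊆ (p⊆p∪q U′ ∘ f) (q⊆p∪q S′ U′ ∘ g)

insert-mono : ∀ {n} (x : Fin n) {S U : Subset n} → S ⊆ U → ⁅ x ⁆ ∪ S ⊆ ⁅ x ⁆ ∪ U
insert-mono x = ∪-mono {S = ⁅ x ⁆} id

∈-insert⁻ : ∀ {n} {x y : Fin n} (S : Subset n) → y ∈ ⁅ x ⁆ ∪ S → y ≡ x ⊎ y ∈ S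
∈-insert⁻ {x = x} S y∈ with x∈p∪q⁻ ⁅ x ⁆ S y∈
... | inj₁ y∈x = inj₁ (x∈⁅y⁆⇒x≡y x y∈x)
... | inj₂ y∈S = inj₂ y∈S

∣∪∣+∣∩∣ : ∀ {n} (p q : Subset n) → ∣ p ∪ q ∣ + ∣ p ∩ q ∣ ≡ ∣ p ∣ + ∣ q ∣
∣∪∣+∣∩∣ [] [] = refl
∣∪∣+∣∩∣ (true ∷ p) (true ∷ q) =
  cong suc (trans (+-suc _ _) (trans (cong suc (∣∪∣+∣∩∣ p q)) (sym (+-suc _ _))))
∣∪∣+∣∩∣ (true ∷ p) (false ∷ q) = cong suc (∣∪∣+∣∩∣ p q)
∣∪∣+∣∩∣ (false ∷ p) (true ∷ q) = trans (cong suc (∣∪∣+∣∩∣ p q)) (sym (+-suc _ _))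
∣∪∣+∣∩∣ (false ∷ p) (false ∷ q) = ∣∪∣+∣∩∣ p q

∣∪∣≤ : ∀ {n} (p q : Subset n) → ∣ p ∪ q ∣ ≤ ∣ p ∣ + ∣ q ∣
∣∪∣≤ p q = ≤-trans (m≤m+n _ _) (≤-reflexive (∣∪∣+∣∩∣ p q))

∣∪∣-disjoint : ∀ {n} {p q : Subset n} → (∀ {x} → x ∈ p → x ∉ q) → ∣ p ∪ q ∣ ≡ ∣ p ∣ + ∣ q ∣
∣∪∣-disjoint {n} {p} {q} disj = trans (sym (+-identityʳ _)) (trans (cong (∣ p ∪ q ∣ +_) (sym empty)) (∣∪∣+∣∩∣ p q))
  where
  empty : ∣ p ∩ q ∣ ≡ 0
  empty = trans (cong ∣_∣ (Empty-unique λ (x , x∈) →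
    let x∈p , x∈q = x∈p∩q⁻ p q x∈ in disj x∈p x∈q)) (∣⊥∣≡0 n)

∣insert∣≤ : ∀ {n} (x : Fin n) (S : Subset n) → ∣ ⁅ x ⁆ ∪ S ∣ ≤ suc ∣ S ∣
∣insert∣≤ x S = ≤-trans (∣∪∣≤ ⁅ x ⁆ S) (≤-reflexive (cong (_+ ∣ S ∣) (∣⁅x⁆∣≡1 x)))

∣insert∣ : ∀ {n} {x : Fin n} {S : Subset n} → x ∉ S → ∣ ⁅ x ⁆ ∪ S ∣ ≡ suc ∣ S ∣
∣insert∣ {x = x} {S} x∉S = trans
  (∣∪∣-disjoint λ y∈x y∈S → x∉S (subst (_∈ S) (x∈⁅y⁆⇒x≡y x y∈x) y∈S))
  (cong (_+ ∣ S ∣) (∣⁅x⁆∣≡1 x))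

x∉p-x : ∀ {n} {x : Fin n} (p : Subset n) → x ∉ p - x
x∉p-x {x = zero}  (true ∷ p)  ()
x∉p-x {x = zero}  (false ∷ p) ()
x∉p-x {x = suc x} (b ∷ p) (there x∈) = x∉p-x p x∈

select : ∀ {n ℓ} {P : Pred (Fin n) ℓ} → Decidable P → Subset n
select P? = tabulate (does ∘ P?)

∈-select⁺ : ∀ {n ℓ} {P : Pred (Fin n) ℓ} (P? : Decidable P) {x} → P x → x ∈ select P?
∈-select⁺ P? {x} Px with P? x | lookup∘tabulate (does ∘ P?) x
... | yes _  | eq = lookup⇒[]= x _ eq
... | no ¬Px | _  = contradiction Px ¬Px

∈-select⁻ : ∀ {n ℓ} {P : Pred (Fin n) ℓ} (P? : Decidable P) {x} → x ∈ select P? → P x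
∈-select⁻ P? {x} x∈ with P? x | trans (sym (lookup∘tabulate (does ∘ P?) x)) ([]=⇒lookup x∈)
... | yes Px | _ = Px

-- Exchange arguments in matroids

-- For independent `S` this is membership in the closure of `S`, phrased through the oracle so that
-- neither rank nor closure has to be developed.
Covered : ∀ {m} → Matroid m → Subset m → Fin m → Set
Covered M S x = x ∉ S → ¬ Independent M (⁅ x ⁆ ∪ S)

independent? : ∀ {m} (M : Matroid m) S → Dec (Independent M S)
independent? M S = T? (oracle M S)

covered? : ∀ {m} (M : Matroid m) S → Decidable (Covered M S)
covered? M S x = ¬? (x ∈? S) →-dec ¬? (independent? M _)

covered-mono : ∀ {m} (M : Matroid m) {S U x} → S ⊆ U → Covered M S x → Covered M U x
covered-mono M {x = x} S⊆U cov x∉U = cov (x∉U ∘ S⊆U) ∘ hereditary M (insert-mono x S⊆U)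

covered-∣∣≤ : ∀ {m} (M : Matroid m) {A S} → Independent M A → Independent M S →
              (∀ {x} → x ∈ A → Covered M S x) → ∣ A ∣ ≤ ∣ S ∣
covered-∣∣≤ M A∈I S∈I cov = ≮⇒≥ λ ∣S∣<∣A∣ →
  let x , x∈A , x∉S , x+S∈I = exchange M S∈I A∈I ∣S∣<∣A∣ in cov x∈A x∉S x+S∈I

extend : ∀ {m} (M : Matroid m) {I J} → Independent M I → Independent M J →
         ∃[ A ] Independent M A × I ⊆ A × A ⊆ I ∪ J × ∣ J ∣ ≤ ∣ A ∣
extend M {I} {J} I∈I J∈I = go ∣ J ∣ I I∈I id (p⊆p∪q J) (m≤m+n ∣ J ∣ ∣ I ∣)
  where
  go : ∀ c A → Independent M A → I ⊆ A → A ⊆ I ∪ J → ∣ J ∣ ≤ c + ∣ A ∣ →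
       ∃[ A ] Independent M A × I ⊆ A × A ⊆ I ∪ J × ∣ J ∣ ≤ ∣ A ∣
  go zero A A∈I I⊆A A⊆ ∣J∣≤ = A , A∈I , I⊆A , A⊆ , ∣J∣≤
  go (suc c) A A∈I I⊆A A⊆ ∣J∣≤ with ∣ J ∣ ≤? ∣ A ∣
  ... | yes ∣J∣≤∣A∣ = A , A∈I , I⊆A , A⊆ , ∣J∣≤∣A∣
  ... | no ∣J∣≰∣A∣ =
    let x , x∈J , x∉A , x+A∈I = exchange M A∈I J∈I (≰⇒> ∣J∣≰∣A∣) in
    go c (⁅ x ⁆ ∪ A) x+A∈I (q⊆p∪q ⁅ x ⁆ A ∘ I⊆A) (insert-⊆ (q⊆p∪q I J x∈J) A⊆)
      (≤-trans ∣J∣≤ (≤-reflexive (trans (sym (+-suc c ∣ A ∣)) (cong (c +_) (sym (∣insert∣ x∉A))))))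

-- In the contraction by `S` the set `C` is independent, and `A` lies in the closure of `S`; hence
-- `C` stays independent over `A` as well. This is why the two searches cannot collide: `A` will be
-- what the first search made of `T`, and `C` the picks of the second.
covered-∪-independent : ∀ {m} (M : Matroid m) {A C S} → Independent M A →
  (∀ {x} → x ∈ A → Covered M S x) → Independent M (S ∪ C) → (∀ {x} → x ∈ C → x ∉ S) →
  Independent M (A ∪ C)
covered-∪-independent M {A} {C} {S} A∈I cov S∪C∈I C∉S
  with A′ , A′∈I , A⊆A′ , A′⊆ , ∣S∪C∣≤ ← extend M A∈I S∪C∈I =
  hereditary M (∪-⊆ A⊆A′ C⊆A′) A′∈I
  where
  module _ {x} (x∈C : x ∈ C) (x∉A′ : x ∉ A′) where
    F = (S ∪ C) - x
    S⊆F : S ⊆ F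
    S⊆F y∈S = x∈p∧x≢y⇒x∈p-y (p⊆p∪q C y∈S) λ { refl → C∉S x∈C y∈S }
    impossible : Empty.⊥
    -- `F` is smaller than `A′`, so some `y` of `A′` outside `F` fits it. If `y` is in `A`, it is
    -- covered by `S` and hence by `F`; otherwise only `y = x` remains, but `x` is missing from
    -- `A′`.
    impossible with y , y∈A′ , y∉F , y+F∈I ← exchange M (hereditary M (p─q⊆p (S ∪ C) ⁅ x ⁆) S∪C∈I) A′∈I
                      (<-≤-trans (x∈p⇒∣p-x∣<∣p∣ (q⊆p∪q S C x∈C)) ∣S∪C∣≤)
      with x∈p∪q⁻ A (S ∪ C) (A′⊆ y∈A′)
    ... | inj₁ y∈A = cov y∈A (y∉F ∘ S⊆F) (hereditary M (insert-mono y S⊆F) y+F∈I)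
    ... | inj₂ y∈S∪C = y∉F (x∈p∧x≢y⇒x∈p-y y∈S∪C λ { refl → x∉A′ y∈A′ })
  C⊆A′ : C ⊆ A′
  C⊆A′ {x} x∈C with x ∈? A′
  ... | yes x∈A′ = x∈A′
  ... | no x∉A′ = ⊥-elim (impossible x∈C x∉A′)

⊈-witness : ∀ {n} {p q : Subset n} → ¬ (p ⊆ q) → ∃[ x ] x ∈ p × x ∉ q
⊈-witness {p = p} {q} p⊈q with any? (λ x → x ∈? p ×-dec ¬? (x ∈? q))
... | yes found = found
... | no none = ⊥-elim (p⊈q λ {x} x∈p → sub x x∈p)
  where
  sub : ∀ x → x ∈ p → x ∈ q
  sub x x∈p with x ∈? q
  ... | yes x∈q = x∈q
  ... | no x∉q = ⊥-elim (none (x , x∈p , x∉q))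

-- As `S` covers `e + B` and is no larger than `B`, the set `e + B` is dependent, so `e` closes a
-- circuit with `B`. That circuit is not contained in `e + X`, hence has an element `t` outside `X`,
-- and removing `t` destroys it. Circuits are avoided by extending `e + X` to `A` inside `e + B`:
-- `A` turns out to be `e + B` without `t`.
fundamental-exchange : ∀ {m} (M : Matroid m) {B S X e} →
  Independent M B → Independent M S → ∣ S ∣ ≤ ∣ B ∣ →
  X ⊆ B → e ∉ B → Independent M (⁅ e ⁆ ∪ X) →
  (∀ {x} → x ∈ ⁅ e ⁆ ∪ B → Covered M S x) →
  ∃[ t ] t ∈ B × t ∉ X × (∀ {U} → U ⊆ ⁅ e ⁆ ∪ B → t ∉ U → Independent M U)
fundamental-exchange M {B} {S} {X} {e} B∈I S∈I ∣S∣≤∣B∣ X⊆B e∉B e+X∈I cov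
  with A , A∈I , e+X⊆A , A⊆ , ∣B∣≤∣A∣ ← extend M e+X∈I B∈I
  with t , t∈ , t∉A ← ⊈-witness {p = ⁅ e ⁆ ∪ B} {A} (λ e+B⊆A →
         <-irrefl refl (≤-trans (≤-trans (≤-reflexive (sym (∣insert∣ e∉B)))
           (covered-∣∣≤ M (hereditary M e+B⊆A A∈I) S∈I cov)) ∣S∣≤∣B∣))
  with ∈-insert⁻ B t∈
... | inj₁ refl = contradiction (e+X⊆A (∈-insert e X)) t∉A
... | inj₂ t∈B = t , t∈B , t∉A ∘ e+X⊆A ∘ q⊆p∪q ⁅ e ⁆ X , λ {U} U⊆ t∉U → hereditary M (U⊆A U⊆ t∉U) A∈I
  where
  A⊆e+B : A ⊆ ⁅ e ⁆ ∪ B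
  A⊆e+B = ∪-⊆ (insert-mono e X⊆B) (q⊆p∪q ⁅ e ⁆ B) ∘ A⊆
  U⊆A : ∀ {U} → U ⊆ ⁅ e ⁆ ∪ B → t ∉ U → U ⊆ A
  U⊆A U⊆ t∉U {y} y∈U with y ∈? A
  ... | yes y∈A = y∈A
  -- If `A` missed `y` in addition to `t`, it would have fewer elements than `B`.
  ... | no y∉A = ⊥-elim (<-irrefl refl (begin-strict
    ∣ A ∣                     ≤⟨ p⊆q⇒∣p∣≤∣q∣ A⊆-t-y ⟩
    ∣ (⁅ e ⁆ ∪ B) - t - y ∣   <⟨ x∈p⇒∣p-x∣<∣p∣ (x∈p∧x≢y⇒x∈p-y (U⊆ y∈U) λ { refl → t∉U y∈U }) ⟩
    ∣ (⁅ e ⁆ ∪ B) - t ∣       ≤⟨ ≤-pred (≤-trans (x∈p⇒∣p-x∣<∣p∣ t∈) (∣insert∣≤ e B)) ⟩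
    ∣ B ∣                     ≤⟨ ∣B∣≤∣A∣ ⟩
    ∣ A ∣                     ∎))
    where
    open ≤-Reasoning
    A⊆-t-y : A ⊆ (⁅ e ⁆ ∪ B) - t - y
    A⊆-t-y z∈A = x∈p∧x≢y⇒x∈p-y (x∈p∧x≢y⇒x∈p-y (A⊆e+B z∈A) λ { refl → t∉A z∈A }) λ { refl → y∉A z∈A }

-- Arrival sequences

∈-image⁺ : ∀ {m k} (es : Vec (Fin m) k) {S i} → i ∈ S → lookup es i ∈ image es S
∈-image⁺ (e ∷ es) here = ∈-insert e _
∈-image⁺ (e ∷ es) {true ∷ S} (there i∈S) = q⊆p∪q ⁅ e ⁆ _ (∈-image⁺ es i∈S)
∈-image⁺ (e ∷ es) {false ∷ S} (there i∈S) = ∈-image⁺ es i∈S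

∈-image⁻ : ∀ {m k} (es : Vec (Fin m) k) S {x} → x ∈ image es S → ∃[ i ] i ∈ S × x ≡ lookup es i
∈-image⁻ [] [] x∈ = contradiction x∈ ∉⊥
∈-image⁻ (e ∷ es) (true ∷ S) x∈ with ∈-insert⁻ (image es S) x∈
... | inj₁ refl = zero , here , refl
... | inj₂ x∈′ = let i , i∈ , eq = ∈-image⁻ es S x∈′ in suc i , there i∈ , eq
∈-image⁻ (e ∷ es) (false ∷ S) x∈ =
  let i , i∈ , eq = ∈-image⁻ es S x∈ in suc i , there i∈ , eq

image-mono : ∀ {m k} (es : Vec (Fin m) k) {S U} → S ⊆ U → image es S ⊆ image es U
image-mono es {S} S⊆U x∈ with _ , i∈S , refl ← ∈-image⁻ es S x∈ = ∈-image⁺ es (S⊆U i∈S)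

image-⊥ : ∀ {m k} (es : Vec (Fin m) k) → image es ⊥ ≡ ⊥
image-⊥ [] = refl
image-⊥ (e ∷ es) = image-⊥ es

image-∪ : ∀ {m k} (es : Vec (Fin m) k) S U → image es (S ∪ U) ≡ image es S ∪ image es U
image-∪ es S U = ⊆-antisym to (∪-⊆ (image-mono es (p⊆p∪q U)) (image-mono es (q⊆p∪q S U)))
  where
  to : image es (S ∪ U) ⊆ image es S ∪ image es U
  to x∈ with _ , i∈ , refl ← ∈-image⁻ es (S ∪ U) x∈ with x∈p∪q⁻ S U i∈
  ... | inj₁ i∈S = p⊆p∪q _ (∈-image⁺ es i∈S)
  ... | inj₂ i∈U = q⊆p∪q _ _ (∈-image⁺ es i∈U)

image-⁅⁆ : ∀ {m k} (es : Vec (Fin m) k) i → image es ⁅ i ⁆ ≡ ⁅ lookup es i ⁆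
image-⁅⁆ (e ∷ es) zero = trans (cong (⁅ e ⁆ ∪_) (image-⊥ es)) (∪-identityʳ _)
image-⁅⁆ (e ∷ es) (suc i) = image-⁅⁆ es i

∣image∣≤ : ∀ {m k} (es : Vec (Fin m) k) S → ∣ image es S ∣ ≤ ∣ S ∣
∣image∣≤ {m} [] [] = ≤-reflexive (∣⊥∣≡0 m)
∣image∣≤ (e ∷ es) (true ∷ S) = ≤-trans (∣insert∣≤ e _) (s≤s (∣image∣≤ es S))
∣image∣≤ (e ∷ es) (false ∷ S) = ∣image∣≤ es S

image-cons : ∀ {m k ℓ} (P : Subset m → Set ℓ) e (es : Vec (Fin m) k) b S →
             (T b → P (⁅ e ⁆ ∪ image es S)) → P (image es S) → P (image (e ∷ es) (b ∷ S))
image-cons P e es true  S f p = f _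
image-cons P e es false S f p = p

∉-image : ∀ {m k} {e : Fin m} {es : Vec (Fin m) k} → All (e ≢_) es → ∀ S → e ∉ image es S
∉-image {es = es} e∉es S e∈ with i , _ , eq ← ∈-image⁻ es S e∈ = All.lookup⁺ e∉es i eq

∣image∣ : ∀ {m k} {es : Vec (Fin m) k} → Unique es → ∀ S → ∣ image es S ∣ ≡ ∣ S ∣
∣image∣ {m} [] [] = ∣⊥∣≡0 m
∣image∣ (e∉es ∷ uniq) (true ∷ S) = trans (∣insert∣ (∉-image e∉es S)) (cong suc (∣image∣ uniq S))
∣image∣ (e∉es ∷ uniq) (false ∷ S) = ∣image∣ uniq S

count : ∀ {m k} → Subset m → Vec (Fin m) k → ℕ
count B es = ∣ map (lookup B) es ∣

∣∣≤count : ∀ {m k} {es : Vec (Fin m) k} {B} → (∀ {x} → x ∈ B → ∃[ i ] lookup es i ≡ x) →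
           ∣ B ∣ ≤ count B es
∣∣≤count {es = es} {B} surj =
  ≤-trans (p⊆q⇒∣p∣≤∣q∣ B⊆image) (∣image∣≤ es (map (lookup B) es))
  where
  B⊆image : B ⊆ image es (map (lookup B) es)
  B⊆image x∈B with i , refl ← surj x∈B =
    ∈-image⁺ es (lookup⇒[]= i _ (trans (lookup-map i (lookup B) es) ([]=⇒lookup x∈B)))

-- The marked greedy algorithm

-- Forgets the latest arrival. By computation `restrict (observed M (e ∷ es))` is `observed M es`,
-- so recursion on the oracles replays the run on the earlier arrivals.
restrict : ∀ {k} → Oracle (suc k) → Oracle k
restrict o S = o (outside ∷ S)

-- The arrival at the head of k earlier ones is among the first a arrivals iff k < a.
accepted : ℕ → ∀ {k} → Oracle k → Oracle k → Subset k
accepted a {zero}  o₁ o₂ = []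
accepted a {suc k} o₁ o₂ = ((k <ᵇ a) ∧ (o₁ (inside ∷ t) ∧ o₂ (inside ∷ t))) ∷ t
  where t = accepted a (restrict o₁) (restrict o₂)

-- A coin is indexed by the number of arrivals before its element, so it does not change as the
-- history grows.
marks : (ℕ → Bool) → ∀ k → Subset k
marks D zero    = []
marks D (suc k) = D k ∷ marks D k

-- Requiring independence from all of t, not only from the kept part, under o₂ is what
-- keeps this search compatible with the one for the interchanged oracles.
augment : ℕ → (ℕ → Bool) → ∀ {k} → Oracle k → Oracle k → Subset k
augment a D {zero}  o₁ o₂ = []
augment a D {suc k} o₁ o₂ =
  (not (k <ᵇ a) ∧ (not (o₁ (inside ∷ t)) ∧
    (o₁ (inside ∷ (t ∩ marks D k) ∪ n) ∧ o₂ (inside ∷ t ∪ n)))) ∷ n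
  where
  t = accepted a (restrict o₁) (restrict o₂)
  n = augment a D (restrict o₁) (restrict o₂)

marked-greedy : ℕ → (ℕ → Bool) → ∀ {k} → Oracle k → Oracle k → Subset k
marked-greedy a D {k} o₁ o₂ =
  (accepted a o₁ o₂ ∩ marks D k) ∪ (augment a D o₁ o₂ ∪ augment a D o₂ o₁)

accepted-comm : ∀ a {k} (o₁ o₂ : Oracle k) → accepted a o₁ o₂ ≡ accepted a o₂ o₁
accepted-comm a {zero}  o₁ o₂ = refl
accepted-comm a {suc k} o₁ o₂
  rewrite accepted-comm a (restrict o₁) (restrict o₂) =
  cong (λ b → ((k <ᵇ a) ∧ b) ∷ accepted a (restrict o₂) (restrict o₁)) (∧-comm (o₁ _) (o₂ _))

marked-greedy-comm : ∀ a D {k} (o₁ o₂ : Oracle k) →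
  marked-greedy a D o₁ o₂ ≡ marked-greedy a D o₂ o₁
marked-greedy-comm a D {k} o₁ o₂ =
  cong₂ _∪_ (cong (_∩ marks D k) (accepted-comm a o₁ o₂)) (∪-comm _ _)

-- Feasibility of the marked greedy algorithm

T-∧⁻ : ∀ {a b} → T (a ∧ b) → T a × T b
T-∧⁻ = Equivalence.to T-∧

T-∧⁺ : ∀ {a b} → T a → T b → T (a ∧ b)
T-∧⁺ p q = Equivalence.from T-∧ (p , q)

T-not⁻ : ∀ {b} → T (not b) → ¬ T b
T-not⁻ {false} _ ()

T-not⁺ : ∀ {b} → ¬ T b → T (not b)
T-not⁺ {false} _ = _
T-not⁺ {true} f = f _

module _ {m} (M₁ M₂ : Matroid m) (a : ℕ) where

  Greedy : ∀ {k} → Vec (Fin m) k → Subset m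
  Greedy es = image es (accepted a (observed M₁ es) (observed M₂ es))

  Greedy-independent : ∀ {k} (es : Vec (Fin m) k) → CommonIndependent M₁ M₂ (Greedy es)
  Greedy-independent [] = ⊥-independent M₁ , ⊥-independent M₂
  Greedy-independent {suc k} (e ∷ es) =
    image-cons (CommonIndependent M₁ M₂) e es _ _
      (λ t → T-∧⁻ (proj₂ (T-∧⁻ {k <ᵇ a} t))) (Greedy-independent es)

  Greedy-⊆ : ∀ {k} e (es : Vec (Fin m) k) → Greedy es ⊆ Greedy (e ∷ es)
  Greedy-⊆ e es = image-cons (Greedy es ⊆_) e es _ _ (λ _ → q⊆p∪q ⁅ e ⁆ _) id


<⇒<ᵇ≡ : ∀ {k a} → k < a → (k <ᵇ a) ≡ true
<⇒<ᵇ≡ k<a = Equivalence.to T-≡ (<⇒<ᵇ k<a)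

augment-early : ∀ {a k} D (o₁ o₂ : Oracle k) → k ≤ a → augment a D o₁ o₂ ≡ ⊥
augment-early {k = zero}  D o₁ o₂ k≤a = refl
augment-early {k = suc k} D o₁ o₂ k<a
  rewrite <⇒<ᵇ≡ k<a | augment-early D (restrict o₁) (restrict o₂) (<⇒≤ k<a) = refl

≮⇒<ᵇ≡ : ∀ {k a} → ¬ k < a → (k <ᵇ a) ≡ false
≮⇒<ᵇ≡ {k} {a} k≮a with k <ᵇ a in eq
... | false = refl
... | true  = contradiction (<ᵇ⇒< k a (Equivalence.from T-≡ eq)) k≮a

module MarkedGreedy {m} (M₁ M₂ : Matroid m) (a : ℕ) (D : ℕ → Bool) where

  acc kept aug : ∀ {k} → Vec (Fin m) k → Subset k
  acc es  = accepted a (observed M₁ es) (observed M₂ es)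
  kept es = acc es ∩ marks D _
  aug es  = augment a D (observed M₁ es) (observed M₂ es)

  candidate : ∀ {k} → Fin m → Vec (Fin m) k → Bool
  candidate e es = not (oracle M₁ (⁅ e ⁆ ∪ image es (acc es))) ∧
    (oracle M₁ (⁅ e ⁆ ∪ image es (kept es ∪ aug es)) ∧
     oracle M₂ (⁅ e ⁆ ∪ image es (acc es ∪ aug es)))

  candidate⁻ : ∀ {k} {e} (es : Vec (Fin m) k) → T (candidate e es) →
    ¬ Independent M₁ (⁅ e ⁆ ∪ image es (acc es)) ×
    Independent M₁ (⁅ e ⁆ ∪ image es (kept es ∪ aug es)) ×
    Independent M₂ (⁅ e ⁆ ∪ image es (acc es ∪ aug es))
  candidate⁻ es t =
    let p , q = T-∧⁻ t ; q₁ , q₂ = T-∧⁻ q in T-not⁻ p , q₁ , q₂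

  kept∪aug-independent : ∀ {k} (es : Vec (Fin m) k) →
    Independent M₁ (image es (kept es ∪ aug es)) × Independent M₂ (image es (acc es ∪ aug es))
  kept∪aug-independent [] = ⊥-independent M₁ , ⊥-independent M₂
  kept∪aug-independent {suc k} (e ∷ es) with k <? a
  ... | yes k<a = subst₂ (λ S U → Independent M₁ (image (e ∷ es) S) × Independent M₂ (image (e ∷ es) U))
    (sym (none (kept (e ∷ es)))) (sym (none (acc (e ∷ es))))
    (hereditary M₁ (image-mono (e ∷ es) (p∩q⊆p (acc (e ∷ es)) (marks D (suc k)))) (proj₁ indep) , proj₂ indep)
    where
    indep = Greedy-independent M₁ M₂ a (e ∷ es)
    none : ∀ S → S ∪ aug (e ∷ es) ≡ S
    none S = trans (cong (S ∪_) (augment-early D (observed M₁ (e ∷ es)) (observed M₂ (e ∷ es)) k<a)) (∪-identityʳ S)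
  ... | no k≮a with ih₁ , ih₂ ← kept∪aug-independent es
    rewrite ≮⇒<ᵇ≡ k≮a =
    image-cons (Independent M₁) e es (candidate e es) (kept es ∪ aug es)
      (proj₁ ∘ proj₂ ∘ candidate⁻ es) ih₁ ,
    image-cons (Independent M₂) e es (candidate e es) (acc es ∪ aug es)
      (proj₂ ∘ proj₂ ∘ candidate⁻ es) ih₂

  -- The search picks only after the first `a` arrivals, when `acc` no longer grows; so the
  -- dependence tested at the arrival of `x` still concerns the final `acc`.
  aug-dependent : ∀ {k} (es : Vec (Fin m) k) {x} → x ∈ image es (aug es) →
                  ¬ Independent M₁ (⁅ x ⁆ ∪ image es (acc es))
  aug-dependent [] x∈ = contradiction x∈ ∉⊥
  aug-dependent {suc k} (e ∷ es) {x} x∈ with k <? a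
  ... | yes k<a = contradiction
    (subst (x ∈_) (trans
      (cong (image (e ∷ es)) (augment-early D (observed M₁ (e ∷ es)) (observed M₂ (e ∷ es)) k<a))
      (image-⊥ (e ∷ es))) x∈) ∉⊥
  ... | no k≮a rewrite ≮⇒<ᵇ≡ k≮a with candidate e es in eq
  ... | false = aug-dependent es x∈
  ... | true with ∈-insert⁻ (image es (aug es)) x∈
  ... | inj₁ refl = proj₁ (candidate⁻ es (Equivalence.from T-≡ eq))
  ... | inj₂ x∈′ = aug-dependent es x∈′

module _ {m} (M₁ M₂ : Matroid m) (a : ℕ) (D : ℕ → Bool) {k} (es : Vec (Fin m) k) where

  private
    module A = MarkedGreedy M₁ M₂ a D
    module B = MarkedGreedy M₂ M₁ a D

    G = image es (A.acc es)

    G≡ : image es (B.acc es) ≡ G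
    G≡ = cong (image es) (accepted-comm a (observed M₂ es) (observed M₁ es))

  -- In the first matroid the kept elements and the picks of the first search stay in the closure of
  -- `G`, whereas the picks of the second search were tested there against all of `G`. So
  -- `covered-∪-independent` applies with `S = G`. The second matroid follows by interchanging the
  -- two.
  marked-greedy-independent : Independent M₁ (image es (marked-greedy a D (observed M₁ es) (observed M₂ es)))
  marked-greedy-independent =
    subst (Independent M₁) (trans (sym (image-∪ es _ _)) (cong (image es) (∪-assoc _ _ _)))
      (covered-∪-independent M₁ {S = G} (proj₁ (A.kept∪aug-independent es)) covered
        (subst (Independent M₁) (trans (image-∪ es _ _) (cong (_∪ image es (B.aug es)) G≡))
          (proj₂ (B.kept∪aug-independent es)))
        λ {x} x∈ x∈G → B.aug-dependent es x∈ (subst (Independent M₂ ∘ (⁅ x ⁆ ∪_)) (sym G≡)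
          (hereditary M₂ (insert-⊆ x∈G id) (proj₂ (Greedy-independent M₁ M₂ a es)))))
    where
    covered : ∀ {x} → x ∈ image es (A.kept es ∪ A.aug es) → Covered M₁ G x
    covered {x} x∈ x∉G with x∈p∪q⁻ _ _ (subst (x ∈_) (image-∪ es (A.kept es) (A.aug es)) x∈)
    ... | inj₁ x∈kept = contradiction (image-mono es (p∩q⊆p (A.acc es) _) x∈kept) x∉G
    ... | inj₂ x∈aug = A.aug-dependent es x∈aug

marked-greedy-common : ∀ {m} (M₁ M₂ : Matroid m) a D {k} (es : Vec (Fin m) k) →
  CommonIndependent M₁ M₂ (image es (marked-greedy a D (observed M₁ es) (observed M₂ es)))
marked-greedy-common M₁ M₂ a D es =
  marked-greedy-independent M₁ M₂ a D es ,
  subst (Independent M₂ ∘ image es) (marked-greedy-comm a D (observed M₂ es) (observed M₁ es))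
    (marked-greedy-independent M₂ M₁ a D es)

-- Random marks and deferred decisions

-- This is `2 ^ n` times the expectation over `n` fair coins.
∑ₛ : ∀ n → (Subset n → ℕ) → ℕ
∑ₛ zero    f = f []
∑ₛ (suc n) f = ∑ₛ n (f ∘ (true ∷_)) + ∑ₛ n (f ∘ (false ∷_))

∑ₛ-mono : ∀ n {f g : Subset n → ℕ} → (∀ D → f D ≤ g D) → ∑ₛ n f ≤ ∑ₛ n g
∑ₛ-mono zero    f≤g = f≤g []
∑ₛ-mono (suc n) f≤g = +-mono-≤ (∑ₛ-mono n (f≤g ∘ _)) (∑ₛ-mono n (f≤g ∘ _))

∑ₛ-cong : ∀ n {f g : Subset n → ℕ} → (∀ D → f D ≡ g D) → ∑ₛ n f ≡ ∑ₛ n g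
∑ₛ-cong n f≡g = ≤-antisym (∑ₛ-mono n (≤-reflexive ∘ f≡g)) (∑ₛ-mono n (≤-reflexive ∘ sym ∘ f≡g))

+-interchange : ∀ a b c d → (a + b) + (c + d) ≡ (a + c) + (b + d)
+-interchange = solve-∀

∑ₛ-+ : ∀ n (f g : Subset n → ℕ) → ∑ₛ n (λ D → f D + g D) ≡ ∑ₛ n f + ∑ₛ n g
∑ₛ-+ zero    f g = refl
∑ₛ-+ (suc n) f g = trans (cong₂ _+_ (∑ₛ-+ n _ _) (∑ₛ-+ n _ _))
  (+-interchange (∑ₛ n (f ∘ (true ∷_))) _ _ _)

∑ₛ-const : ∀ n c → ∑ₛ n (λ _ → c) ≡ 2 ^ n * c
∑ₛ-const zero    c = sym (+-identityʳ c)
∑ₛ-const (suc n) c = trans (cong₂ _+_ (∑ₛ-const n c) (∑ₛ-const n c)) (double (2 ^ n) c)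
  where
  double : ∀ w c → w * c + w * c ≡ (2 * w) * c
  double = solve-∀

-- Conditioning on coin `i`: the pinned summands ignore entry `i`, so each sum on the right meets
-- every vector with that outcome twice.
∑ₛ-pin : ∀ {n} i (f : Subset n → ℕ) →
  2 * ∑ₛ n f ≡ ∑ₛ n (λ D → f (D [ i ]≔ true)) + ∑ₛ n (λ D → f (D [ i ]≔ false))
∑ₛ-pin {suc n} zero f = double (∑ₛ n (f ∘ (true ∷_))) _
  where
  double : ∀ x y → 2 * (x + y) ≡ (x + x) + (y + y)
  double = solve-∀
∑ₛ-pin {suc n} (suc i) f = trans (*-distribˡ-+ 2 (∑ₛ n (f ∘ (true ∷_))) _)
  (trans (cong₂ _+_ (∑ₛ-pin i (f ∘ (true ∷_))) (∑ₛ-pin i (f ∘ (false ∷_))))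
    (+-interchange (∑ₛ n (λ D → f (true ∷ D [ i ]≔ true))) _ _ _))

∑ₛ-∣∩∣ : ∀ {n} (t : Subset n) → 2 * ∑ₛ n (λ D → ∣ t ∩ D ∣) ≡ 2 ^ n * ∣ t ∣
∑ₛ-∣∩∣ [] = refl
∑ₛ-∣∩∣ {suc n} (true ∷ t) = trans (cong (λ x → 2 * (x + y)) (trans (∑ₛ-+ n (λ _ → 1) _) (cong (_+ y) (∑ₛ-const n 1))))
  (trans (lemma (2 ^ n) y) (trans (cong (2 * (2 ^ n) +_) (cong (2 *_) (∑ₛ-∣∩∣ t))) (lemma′ (2 ^ n) ∣ t ∣)))
  where
  y = ∑ₛ n (λ D → ∣ t ∩ D ∣)
  lemma : ∀ w y → 2 * ((w * 1 + y) + y) ≡ 2 * w + 2 * (2 * y)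
  lemma = solve-∀
  lemma′ : ∀ w t → 2 * w + 2 * (w * t) ≡ 2 * w * suc t
  lemma′ = solve-∀
∑ₛ-∣∩∣ {suc n} (false ∷ t) = trans (lemma y) (trans (cong (2 *_) (∑ₛ-∣∩∣ t)) (sym (*-assoc 2 (2 ^ n) ∣ t ∣)))
  where
  y = ∑ₛ n (λ D → ∣ t ∩ D ∣)
  lemma : ∀ y → 2 * (y + y) ≡ 2 * (2 * y)
  lemma = solve-∀

-- The elements charged to `X` must be independent in the first matroid before their number can be
-- bounded by that of `X`. `J` is known to be independent only in the second one, so they are taken
-- from `O`.
covered-∣∣≤+ : ∀ {m} (M₁ M₂ : Matroid m) {J O X Y} →
  Independent M₂ J → Independent M₁ O → Independent M₁ X → Independent M₂ Y →
  (∀ {o} → o ∈ J → Covered M₂ Y o ⊎ (o ∈ O × Covered M₁ X o)) → ∣ J ∣ ≤ ∣ Y ∣ + ∣ X ∣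
covered-∣∣≤+ M₁ M₂ {J} {O} {X} {Y} J∈I O∈I X∈I Y∈I cov = begin
  ∣ J ∣              ≤⟨ p⊆q⇒∣p∣≤∣q∣ J⊆ ⟩
  ∣ J₂ ∪ O₁ ∣        ≤⟨ ∣∪∣≤ J₂ O₁ ⟩
  ∣ J₂ ∣ + ∣ O₁ ∣    ≤⟨ +-mono-≤
    (covered-∣∣≤ M₂ (hereditary M₂ (p∩q⊆p J _) J∈I) Y∈I
      (∈-select⁻ (covered? M₂ Y) ∘ p∩q⊆q J _))
    (covered-∣∣≤ M₁ (hereditary M₁ (p∩q⊆p O _) O∈I) X∈I
      (∈-select⁻ (covered? M₁ X) ∘ p∩q⊆q O _)) ⟩
  ∣ Y ∣ + ∣ X ∣      ∎
  where
  open ≤-Reasoning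
  J₂ = J ∩ select (covered? M₂ Y)
  O₁ = O ∩ select (covered? M₁ X)
  J⊆ : J ⊆ J₂ ∪ O₁
  J⊆ o∈J with cov o∈J
  ... | inj₁ c = p⊆p∪q O₁ (x∈p∩q⁺ (o∈J , ∈-select⁺ (covered? M₂ Y) c))
  ... | inj₂ (o∈O , c) = q⊆p∪q J₂ O₁ (x∈p∩q⁺ (o∈O , ∈-select⁺ (covered? M₁ X) c))

∩-pin-true : ∀ {n} {A : Subset n} {i} D → i ∈ A → A ∩ (D [ i ]≔ true) ≡ ⁅ i ⁆ ∪ ((A - i) ∩ D)
∩-pin-true {A = true ∷ A} (b ∷ D) here = cong (true ∷_)
  (sym (trans (∪-identityˡ _) (cong (_∩ D) (p─⊥≡p A))))
∩-pin-true {A = true ∷ A} (b ∷ D) (there i∈A) = cong (b ∷_) (∩-pin-true D i∈A)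
∩-pin-true {A = false ∷ A} (b ∷ D) (there i∈A) = cong (false ∷_) (∩-pin-true D i∈A)

∩-pin-false : ∀ {n} (A : Subset n) i D → A ∩ (D [ i ]≔ false) ≡ (A - i) ∩ D
∩-pin-false (true ∷ A) zero (b ∷ D) = cong (false ∷_) (cong (_∩ D) (sym (p─⊥≡p A)))
∩-pin-false (false ∷ A) zero (b ∷ D) = cong (false ∷_) (cong (_∩ D) (sym (p─⊥≡p A)))
∩-pin-false (true ∷ A) (suc i) (b ∷ D) = cong (b ∷_) (∩-pin-false A i D)
∩-pin-false (false ∷ A) (suc i) (b ∷ D) = cong (false ∷_) (∩-pin-false A i D)

∈-- : ∀ {n} {A : Subset n} {i j} → j ∈ A - i → j ∈ A × j ≢ i
∈-- {A = A} {i} j∈ = p─q⊆p A ⁅ i ⁆ j∈ , λ { refl → x∉p-x A j∈ }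

-- One augmenting search, with its coins tossed lazily

module Augmentation {m} (M₁ M₂ : Matroid m) (S : Subset m) where

  -- `S` is the final greedy set of the first phase. `Z` stands for its kept part and `Y` for all of
  -- it, each together with the picks made so far.
  acceptable : Subset m → Subset m → Fin m → Bool
  acceptable Z Y e = not (oracle M₁ (⁅ e ⁆ ∪ S)) ∧ (oracle M₁ (⁅ e ⁆ ∪ Z) ∧ oracle M₂ (⁅ e ⁆ ∪ Y))

  step : Subset m × Subset m → Fin m → Subset m × Subset m
  step (Z , Y) e = if acceptable Z Y e then (⁅ e ⁆ ∪ Z , ⁅ e ⁆ ∪ Y) else (Z , Y)

  step-reject : ∀ {Z Y e} → ¬ T (acceptable Z Y e) → step (Z , Y) e ≡ (Z , Y)
  step-reject {Z} {Y} {e} ¬t with acceptable Z Y e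
  ... | true  = contradiction _ ¬t
  ... | false = refl

  step-accept : ∀ {Z Y e} → T (acceptable Z Y e) → step (Z , Y) e ≡ (⁅ e ⁆ ∪ Z , ⁅ e ⁆ ∪ Y)
  step-accept {Z} {Y} {e} t with acceptable Z Y e
  ... | true  = refl

  module Sampling {J O : Subset m} (S∈I : Independent M₁ S) (J∈I : Independent M₂ J) (O∈I : Independent M₁ O)
           {n} {es : Vec (Fin m) n} (uniq : Unique es) where

    -- X consists of the picks and of the elements already known to be kept; the coins of
    -- the positions in A are not tossed yet.
    record Invariant (X : Subset m) (A : Subset n) (Y : Subset m) (s : List (Fin m)) : Set where
      field
        base    : Independent M₁ (X ∪ image es A)
        size    : ∣ S ∣ ≤ ∣ X ∪ image es A ∣
        covered : ∀ {x} → x ∈ X ∪ image es A → Covered M₁ S x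
        base⊆Y  : X ∪ image es A ⊆ Y
        Y∈I     : Independent M₂ Y
        fresh   : ListAll.All (_∉ Y) s
        unique  : ListUnique.Unique s
        target  : ∀ {o} → o ∈ J → Covered M₂ Y o ⊎
                  (o ∈ O × (Covered M₁ X o ⊎ (o ∈ₗ s × ¬ Independent M₁ (⁅ o ⁆ ∪ S))))

    open Invariant

    final : List (Fin m) → Subset m → Subset n → Subset m → Subset n → ℕ
    final s X A Y D = ∣ proj₂ (foldl step (X ∪ image es (A ∩ D) , Y) s) ∣

    -- A coin toss adds one element to X, and one to Y half of the time, so 2 ∣ Y ∣ - ∣ X ∣
    -- has constant expectation; in the end ∣ J ∣ ≤ ∣ X ∣ + ∣ Y ∣.
    Goal : Subset m → Subset n → Subset m → List (Fin m) → Set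
    Goal X A Y s = 2 ^ n * ∣ J ∣ + 2 * (2 ^ n * ∣ Y ∣) ≤ 3 * ∑ₛ n (final s X A Y) + 2 ^ n * ∣ X ∣

    skip : ∀ {X A Y e s} → (∀ D → ¬ T (acceptable (X ∪ image es (A ∩ D)) Y e)) →
           Goal X A Y s → Goal X A Y (e ∷ s)
    skip {X} {A} {Y} {e} {s} rej g = ≤-trans g (≤-reflexive (cong (λ x → 3 * x + 2 ^ n * ∣ X ∣)
      (∑ₛ-cong n λ D → sym (cong (λ st → ∣ proj₂ (foldl step st s) ∣) (step-reject (rej D))))))

    skip-invariant : ∀ {X A Y e s} → Invariant X A Y (e ∷ s) →
      (¬ Independent M₁ (⁅ e ⁆ ∪ S) → Covered M₂ Y e ⊎ Covered M₁ X e) → Invariant X A Y s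
    skip-invariant {X} {A} {Y} {e} {s} inv cov = record
      { base = base inv ; size = size inv ; covered = covered inv ; base⊆Y = base⊆Y inv ; Y∈I = Y∈I inv
      ; fresh = ListAll.tail (fresh inv) ; unique = AllPairs.tail (unique inv) ; target = target′ }
      where
      target′ : ∀ {o} → o ∈ J → Covered M₂ Y o ⊎
                  (o ∈ O × (Covered M₁ X o ⊎ (o ∈ₗ s × ¬ Independent M₁ (⁅ o ⁆ ∪ S))))
      target′ o∈J with target inv o∈J
      ... | inj₁ c = inj₁ c
      ... | inj₂ (o∈O , inj₁ c) = inj₂ (o∈O , inj₁ c)
      ... | inj₂ (o∈O , inj₂ (ListAny.there o∈s , dep)) = inj₂ (o∈O , inj₂ (o∈s , dep))
      ... | inj₂ (o∈O , inj₂ (ListAny.here refl , dep)) with cov dep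
      ... | inj₁ c = inj₁ c
      ... | inj₂ c = inj₂ (o∈O , inj₁ c)

    private
      module Setup {X A Y e s} (inv : Invariant X A Y (e ∷ s)) (dep : ¬ Independent M₁ (⁅ e ⁆ ∪ S)) where

        B = X ∪ image es A

        e∉Y : e ∉ Y
        e∉Y = ListAll.head (fresh inv)

        e∉B : e ∉ B
        e∉B = e∉Y ∘ base⊆Y inv

        cov : ∀ {x} → x ∈ ⁅ e ⁆ ∪ B → Covered M₁ S x
        cov x∈ with ∈-insert⁻ B x∈
        ... | inj₁ refl = λ _ → dep
        ... | inj₂ x∈B = covered inv x∈B

    Exchangeable : Subset m → Subset n → Fin m → Fin n → Set
    Exchangeable X A e i = i ∈ A × lookup es i ∉ X ×
      (∀ {U} → U ⊆ ⁅ e ⁆ ∪ (X ∪ image es A) → lookup es i ∉ U → Independent M₁ U)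

    -- This finds the coin to be tossed next. The invariant says that `X` with the undecided
    -- elements is as large as `S` and covered by it, so `e` closes a circuit there. As `e` fits
    -- `X`, the circuit contains an element whose coin is still open.
    exchangeable : ∀ {X A Y e s} → Invariant X A Y (e ∷ s) → ¬ Independent M₁ (⁅ e ⁆ ∪ S) →
                   Independent M₁ (⁅ e ⁆ ∪ X) → ∃[ i ] Exchangeable X A e i
    exchangeable {X} {A} inv dep e+X∈I
      with t , t∈B , t∉X , rest ← fundamental-exchange M₁ (base inv) S∈I (size inv) (p⊆p∪q (image es A))
             (Setup.e∉B inv dep) e+X∈I (Setup.cov inv dep)
      with x∈p∪q⁻ X (image es A) t∈B
    ... | inj₁ t∈X = contradiction t∈X t∉X
    ... | inj₂ t∈A with i , i∈A , refl ← ∈-image⁻ es A t∈A = i , i∈A , t∉X , rest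

    module Reveal {X A Y e s} (inv : Invariant X A Y (e ∷ s))
      (dep : ¬ Independent M₁ (⁅ e ⁆ ∪ S)) (e+Y∈I : Independent M₂ (⁅ e ⁆ ∪ Y))
      (i : Fin n) (i∈A : i ∈ A) (t∉X : lookup es i ∉ X)
      (independent : ∀ {U} → U ⊆ ⁅ e ⁆ ∪ (X ∪ image es A) → lookup es i ∉ U → Independent M₁ U) where

      open Setup inv dep

      t = lookup es i

      t∈image : t ∈ image es A
      t∈image = ∈-image⁺ es i∈A

      A′ = A - i

      A′⊆A : image es A′ ⊆ image es A
      A′⊆A = image-mono es (p─q⊆p A ⁅ i ⁆)

      t∉A′ : t ∉ image es A′
      t∉A′ t∈ with j , j∈ , eq ← ∈-image⁻ es A′ t∈ =
        proj₂ (∈-- {A = A} j∈) (lookup-injective uniq j i (sym eq))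

      A⊆t+A′ : image es A ⊆ ⁅ t ⁆ ∪ image es A′
      A⊆t+A′ x∈ with j , j∈A , refl ← ∈-image⁻ es A x∈ with j ≟ i
      ... | yes refl = ∈-insert t _
      ... | no j≢i = q⊆p∪q ⁅ t ⁆ _ (∈-image⁺ es (x∈p∧x≢y⇒x∈p-y j∈A j≢i))

      dropped⊆ : (⁅ e ⁆ ∪ X) ∪ image es A′ ⊆ ⁅ e ⁆ ∪ B
      dropped⊆ = ∪-⊆ (insert-mono e (p⊆p∪q _)) (q⊆p∪q ⁅ e ⁆ B ∘ q⊆p∪q X (image es A) ∘ A′⊆A)

      dropped∈I : Independent M₁ ((⁅ e ⁆ ∪ X) ∪ image es A′)
      dropped∈I = independent dropped⊆
        λ t∈ → [ t∉e+X , t∉A′ ]′ (x∈p∪q⁻ (⁅ e ⁆ ∪ X) _ t∈)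
        where
        t∉e+X : t ∉ ⁅ e ⁆ ∪ X
        t∉e+X t∈ with ∈-insert⁻ X t∈
        ... | inj₁ t≡e = e∉B (subst (_∈ B) t≡e (q⊆p∪q X _ t∈image))
        ... | inj₂ t∈X = t∉X t∈X

      e+B⊆ : ⁅ e ⁆ ∪ B ⊆ ⁅ t ⁆ ∪ ((⁅ e ⁆ ∪ X) ∪ image es A′)
      e+B⊆ = insert-⊆ (q⊆p∪q ⁅ t ⁆ _ (p⊆p∪q _ (∈-insert e X)))
        (∪-⊆ (q⊆p∪q ⁅ t ⁆ _ ∘ p⊆p∪q _ ∘ q⊆p∪q ⁅ e ⁆ X)
             (insert-mono t (q⊆p∪q (⁅ e ⁆ ∪ X) _) ∘ A⊆t+A′))

      -- `e` takes the place of `t`. The base keeps its size because adding `t` back recovers all of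
      -- `e + B`, which has one element more than `B`.
      dropped-invariant : Invariant (⁅ e ⁆ ∪ X) A′ (⁅ e ⁆ ∪ Y) s
      dropped-invariant = record
        { base = dropped∈I
        ; size = ≤-trans (size inv) (≤-pred (≤-trans (≤-reflexive (sym (∣insert∣ e∉B)))
                   (≤-trans (p⊆q⇒∣p∣≤∣q∣ e+B⊆) (∣insert∣≤ t _))))
        ; covered = λ x∈ → cov (dropped⊆ x∈)
        ; base⊆Y = insert-mono e (base⊆Y inv) ∘ dropped⊆
        ; Y∈I = e+Y∈I
        ; fresh = fresh′ (fresh inv) (unique inv)
        ; unique = AllPairs.tail (unique inv)
        ; target = target′ }
        where
        fresh′ : ∀ {s} → ListAll.All (_∉ Y) (e ∷ s) → ListUnique.Unique (e ∷ s) → ListAll.All (_∉ ⁅ e ⁆ ∪ Y) s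
        fresh′ (_ ListAll.∷ fr) (e≢ ∷ _) = ListAll.zipWith
          (λ (x∉Y , e≢x) x∈ → [ e≢x ∘ sym , x∉Y ]′ (∈-insert⁻ Y x∈)) (fr , e≢)
        target′ : ∀ {o} → o ∈ J → Covered M₂ (⁅ e ⁆ ∪ Y) o ⊎
          (o ∈ O × (Covered M₁ (⁅ e ⁆ ∪ X) o ⊎ (o ∈ₗ s × ¬ Independent M₁ (⁅ o ⁆ ∪ S))))
        target′ o∈J with target inv o∈J
        ... | inj₁ c = inj₁ (covered-mono M₂ (q⊆p∪q ⁅ e ⁆ Y) c)
        ... | inj₂ (o∈O , inj₁ c) = inj₂ (o∈O , inj₁ (covered-mono M₁ (q⊆p∪q ⁅ e ⁆ X) c))
        ... | inj₂ (o∈O , inj₂ (ListAny.there o∈s , d)) = inj₂ (o∈O , inj₂ (o∈s , d))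
        -- If `e` itself is a target, it has just entered `Y` and so counts as covered.
        ... | inj₂ (o∈O , inj₂ (ListAny.here refl , d)) = inj₁ (contradiction (∈-insert e Y))

      -- `e` remains at the head of the list: with `t` known to be kept, the fate of `e` may still
      -- depend on further open coins.
      kept-invariant : Invariant (⁅ t ⁆ ∪ X) A′ Y (e ∷ s)
      kept-invariant = record
        { base = hereditary M₁ sub (base inv)
        ; size = ≤-trans (size inv) (p⊆q⇒∣p∣≤∣q∣ (∪-⊆ (p⊆p∪q _ ∘ q⊆p∪q ⁅ t ⁆ X)
            (∪-mono (p⊆p∪q X) id ∘ A⊆t+A′)))
        ; covered = covered inv ∘ sub
        ; base⊆Y = base⊆Y inv ∘ sub
        ; Y∈I = Y∈I inv
        ; fresh = fresh inv
        ; unique = unique inv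
        ; target = Sum.map₂ (map₂ (Sum.map₁ (covered-mono M₁ (q⊆p∪q ⁅ t ⁆ X)))) ∘ target inv }
        where
        sub : (⁅ t ⁆ ∪ X) ∪ image es A′ ⊆ B
        sub = ∪-⊆ (insert-⊆ (q⊆p∪q X _ t∈image) (p⊆p∪q _)) (q⊆p∪q X _ ∘ A′⊆A)

      final-kept : ∀ D → final (e ∷ s) X A Y (D [ i ]≔ true) ≡ final (e ∷ s) (⁅ t ⁆ ∪ X) A′ Y D
      final-kept D = cong (λ Z → ∣ proj₂ (foldl step (Z , Y) (e ∷ s)) ∣) (begin
        X ∪ image es (A ∩ (D [ i ]≔ true))         ≡⟨ cong (λ U → X ∪ image es U) (∩-pin-true D i∈A) ⟩
        X ∪ image es (⁅ i ⁆ ∪ (A′ ∩ D))            ≡⟨ cong (X ∪_) (image-∪ es ⁅ i ⁆ (A′ ∩ D)) ⟩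
        X ∪ (image es ⁅ i ⁆ ∪ image es (A′ ∩ D))   ≡⟨ cong (λ U → X ∪ (U ∪ image es (A′ ∩ D))) (image-⁅⁆ es i) ⟩
        X ∪ (⁅ t ⁆ ∪ image es (A′ ∩ D))            ≡⟨ ∪-assoc X ⁅ t ⁆ _ ⟨
        (X ∪ ⁅ t ⁆) ∪ image es (A′ ∩ D)            ≡⟨ cong (_∪ image es (A′ ∩ D)) (∪-comm X ⁅ t ⁆) ⟩
        (⁅ t ⁆ ∪ X) ∪ image es (A′ ∩ D)            ∎)
        where open ≡-Reasoning

      -- Once `t` is dropped, `e` is accepted whatever the open coins show, because `e` is
      -- independent even of `X` with all remaining undecided elements.
      final-dropped : ∀ D → final (e ∷ s) X A Y (D [ i ]≔ false) ≡ final s (⁅ e ⁆ ∪ X) A′ (⁅ e ⁆ ∪ Y) D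
      final-dropped D = trans
        (cong (λ U → ∣ proj₂ (foldl step (X ∪ image es U , Y) (e ∷ s)) ∣) (∩-pin-false A i D))
        (cong (λ st → ∣ proj₂ (foldl step st s) ∣) (trans (step-accept
          (T-∧⁺ (T-not⁺ dep) (T-∧⁺ (hereditary M₁ (⊆-reflexive (sym (∪-assoc ⁅ e ⁆ X _)))
            (hereditary M₁ (∪-mono {S = ⁅ e ⁆ ∪ X} id (image-mono es (p∩q⊆p A′ D))) dropped∈I)) e+Y∈I)))
          (cong (_, ⁅ e ⁆ ∪ Y) (sym (∪-assoc ⁅ e ⁆ X _)))))

      -- In both outcomes `X` gains at most one element, and `Y` gains one only if `t` is dropped.
      -- In the sum of the two goals either gain amounts to `2 * w`, so they cancel; `∑ₛ-pin` turns
      -- the sum into twice the goal before the toss.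
      average : Goal (⁅ e ⁆ ∪ X) A′ (⁅ e ⁆ ∪ Y) s → Goal (⁅ t ⁆ ∪ X) A′ Y (e ∷ s) → Goal X A Y (e ∷ s)
      average dropped kept = *-cancelˡ-≤ 2 (+-cancelʳ-≤ (2 * w) _ _ (begin
        2 * (w * ∣ J ∣ + 2 * (w * ∣ Y ∣)) + 2 * w
          ≡⟨ lhs w ∣ J ∣ ∣ Y ∣ ⟩
        (w * ∣ J ∣ + 2 * (w * suc ∣ Y ∣)) + (w * ∣ J ∣ + 2 * (w * ∣ Y ∣))
          ≡⟨ cong (λ y → (w * ∣ J ∣ + 2 * (w * y)) + (w * ∣ J ∣ + 2 * (w * ∣ Y ∣))) (∣insert∣ e∉Y) ⟨
        (w * ∣ J ∣ + 2 * (w * ∣ ⁅ e ⁆ ∪ Y ∣)) + (w * ∣ J ∣ + 2 * (w * ∣ Y ∣))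
          ≤⟨ +-mono-≤ dropped kept ⟩
        (3 * d + w * ∣ ⁅ e ⁆ ∪ X ∣) + (3 * k + w * ∣ ⁅ t ⁆ ∪ X ∣)
          ≤⟨ +-mono-≤ (+-monoʳ-≤ (3 * d) (*-monoʳ-≤ w (∣insert∣≤ e X))) (+-monoʳ-≤ (3 * k) (*-monoʳ-≤ w (∣insert∣≤ t X))) ⟩
        (3 * d + w * suc ∣ X ∣) + (3 * k + w * suc ∣ X ∣)
          ≡⟨ rhs w d k ∣ X ∣ ⟩
        3 * (k + d) + 2 * (w * ∣ X ∣) + 2 * w
          ≡⟨ cong (λ x → 3 * x + 2 * (w * ∣ X ∣) + 2 * w) (cong₂ _+_ (∑ₛ-cong n final-kept) (∑ₛ-cong n final-dropped)) ⟨
        3 * (∑ₛ n (λ D → f (D [ i ]≔ true)) + ∑ₛ n (λ D → f (D [ i ]≔ false))) + 2 * (w * ∣ X ∣) + 2 * w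
          ≡⟨ cong (λ x → 3 * x + 2 * (w * ∣ X ∣) + 2 * w) (∑ₛ-pin i f) ⟨
        3 * (2 * ∑ₛ n f) + 2 * (w * ∣ X ∣) + 2 * w
          ≡⟨ rhs′ w (∑ₛ n f) ∣ X ∣ ⟩
        2 * (3 * ∑ₛ n f + w * ∣ X ∣) + 2 * w ∎))
        where
        open ≤-Reasoning
        w = 2 ^ n
        f = final (e ∷ s) X A Y
        d = ∑ₛ n (final s (⁅ e ⁆ ∪ X) A′ (⁅ e ⁆ ∪ Y))
        k = ∑ₛ n (final (e ∷ s) (⁅ t ⁆ ∪ X) A′ Y)
        lhs : ∀ w j y → 2 * (w * j + 2 * (w * y)) + 2 * w ≡ (w * j + 2 * (w * suc y)) + (w * j + 2 * (w * y))
        lhs = solve-∀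
        rhs : ∀ w d k x → (3 * d + w * suc x) + (3 * k + w * suc x) ≡ 3 * (k + d) + 2 * (w * x) + 2 * w
        rhs = solve-∀
        rhs′ : ∀ w f x → 3 * (2 * f) + 2 * (w * x) + 2 * w ≡ 2 * (3 * f + w * x) + 2 * w
        rhs′ = solve-∀

    -- When `t` is kept the list does not get shorter, but the set of open coins does; `c` bounds
    -- the latter and makes the recursion terminate.
    sampling : ∀ s c X A Y → ∣ A ∣ ≤ c → Invariant X A Y s → Goal X A Y s
    sampling [] c X A Y ∣A∣≤c inv = begin
      w * ∣ J ∣ + 2 * (w * ∣ Y ∣)            ≤⟨ +-monoˡ-≤ _ (*-monoʳ-≤ w (covered-∣∣≤+ M₁ M₂ J∈I O∈I
                                                 (hereditary M₁ (p⊆p∪q (image es A)) (base inv)) (Y∈I inv) target′)) ⟩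
      w * (∣ Y ∣ + ∣ X ∣) + 2 * (w * ∣ Y ∣)  ≡⟨ lemma w ∣ Y ∣ ∣ X ∣ ⟩
      3 * (w * ∣ Y ∣) + w * ∣ X ∣            ≡⟨ cong (λ x → 3 * x + w * ∣ X ∣) (∑ₛ-const n ∣ Y ∣) ⟨
      3 * ∑ₛ n (final [] X A Y) + w * ∣ X ∣  ∎
      where
      open ≤-Reasoning
      w = 2 ^ n
      lemma : ∀ w y x → w * (y + x) + 2 * (w * y) ≡ 3 * (w * y) + w * x
      lemma = solve-∀
      target′ : ∀ {o} → o ∈ J → Covered M₂ Y o ⊎ (o ∈ O × Covered M₁ X o)
      target′ o∈J with target inv o∈J
      ... | inj₁ c = inj₁ c
      ... | inj₂ (o∈O , inj₁ c) = inj₂ (o∈O , c)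
    sampling (e ∷ s) c X A Y ∣A∣≤c inv
      with independent? M₁ (⁅ e ⁆ ∪ S)
    ... | yes ind = skip {X} {A} {Y} {e} {s} (λ D t → T-not⁻ (proj₁ (T-∧⁻ {not (oracle M₁ (⁅ e ⁆ ∪ S))} t)) ind)
      (sampling s c X A Y ∣A∣≤c (skip-invariant inv (contradiction ind)))
    ... | no dep with independent? M₂ (⁅ e ⁆ ∪ Y)
    ... | no dep₂ = skip {X} {A} {Y} {e} {s} (λ D t → dep₂ (proj₂
        (T-∧⁻ {oracle M₁ (⁅ e ⁆ ∪ (X ∪ image es (A ∩ D)))} (proj₂ (T-∧⁻ {not (oracle M₁ (⁅ e ⁆ ∪ S))} t)))))
      (sampling s c X A Y ∣A∣≤c (skip-invariant inv λ _ → inj₁ λ _ → dep₂))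
    ... | yes e+Y∈I with independent? M₁ (⁅ e ⁆ ∪ X)
    -- `e` is blocked by elements that are certainly present, so it is rejected for every outcome of
    -- the open coins, and is charged to `X` if it is a target.
    ... | no dep₁ = skip {X} {A} {Y} {e} {s} (λ D t → dep₁ (hereditary M₁ (insert-mono e (p⊆p∪q _)) (proj₁
        (T-∧⁻ {oracle M₁ (⁅ e ⁆ ∪ (X ∪ image es (A ∩ D)))} (proj₂ (T-∧⁻ {not (oracle M₁ (⁅ e ⁆ ∪ S))} t))))))
      (sampling s c X A Y ∣A∣≤c (skip-invariant inv λ _ → inj₂ λ _ → dep₁))
    ... | yes e+X∈I with exchangeable inv dep e+X∈I
    sampling (e ∷ s) zero X A Y ∣A∣≤c inv | no dep | yes e+Y∈I | yes e+X∈I | i , i∈A , _ =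
      contradiction (≤-trans (x∈p⇒∣p-x∣<∣p∣ i∈A) ∣A∣≤c) λ ()
    sampling (e ∷ s) (suc c) X A Y ∣A∣≤c inv | no dep | yes e+Y∈I | yes e+X∈I | i , i∈A , t∉X , rest =
      average (sampling s c (⁅ e ⁆ ∪ X) A′ (⁅ e ⁆ ∪ Y) ∣A′∣≤c dropped-invariant)
              (sampling (e ∷ s) c (⁅ t ⁆ ∪ X) A′ Y ∣A′∣≤c kept-invariant)
      where
      open Reveal inv dep e+Y∈I i i∈A t∉X rest
      ∣A′∣≤c : ∣ A′ ∣ ≤ c
      ∣A′∣≤c = ≤-pred (≤-trans (x∈p⇒∣p-x∣<∣p∣ i∈A) ∣A∣≤c)

-- The online search as a fold over the late arrivals

bit : ∀ {n} → Subset n → ℕ → Bool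
bit []              j = false
-- The head is the coin of the latest arrival, in agreement with the order of entries in `marks`.
bit {suc n} (b ∷ v) j = if j ≡ᵇ n then b else bit v j

marks-cong : ∀ {D D′} k → (∀ {j} → j < k → D j ≡ D′ j) → marks D k ≡ marks D′ k
marks-cong zero    eq = refl
marks-cong (suc k) eq = cong₂ _∷_ (eq ≤-refl) (marks-cong k (eq ∘ m<n⇒m<1+n))

≡ᵇ-refl : ∀ n → (n ≡ᵇ n) ≡ true
≡ᵇ-refl n = Equivalence.to T-≡ (≡⇒≡ᵇ n n refl)

≢⇒≡ᵇ : ∀ {m n} → m ≢ n → (m ≡ᵇ n) ≡ false
≢⇒≡ᵇ {m} {n} m≢n with m ≡ᵇ n in eq
... | false = refl
... | true  = contradiction (≡ᵇ⇒≡ m n (Equivalence.from T-≡ eq)) m≢n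

marks-bit : ∀ {n} (v : Subset n) → marks (bit v) n ≡ v
marks-bit [] = refl
marks-bit {suc n} (b ∷ v) = cong₂ _∷_
  (cong (if_then b else bit v n) (≡ᵇ-refl n))
  (trans (marks-cong n λ {j} j<n → cong (if_then b else bit v j) (≢⇒≡ᵇ (<⇒≢ j<n))) (marks-bit v))

-- A history begins with its latest arrival, whereas the fold needs chronological order; hence `∷ʳ`.
late : ∀ {m} → ℕ → ∀ {k} → Vec (Fin m) k → List (Fin m)
late a []               = []
late a {suc k} (e ∷ es) = if k <ᵇ a then [] else (late a es ∷ʳ e)

late-early : ∀ {m a k} (es : Vec (Fin m) k) → k ≤ a → late a es ≡ []
late-early []       k≤a = refl
late-early (e ∷ es) k<a rewrite <⇒<ᵇ≡ k<a = refl

late-∷ : ∀ {m a k} e (es : Vec (Fin m) k) → ¬ k < a → late a (e ∷ es) ≡ late a es ∷ʳ e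
late-∷ e es k≮a rewrite ≮⇒<ᵇ≡ k≮a = refl

∈-∷ʳ⁻ : ∀ {m} {x y : Fin m} s → x ∈ₗ (s ∷ʳ y) → x ∈ₗ s ⊎ x ≡ y
∈-∷ʳ⁻ s x∈ with ∈-++⁻ s x∈
... | inj₁ x∈s = inj₁ x∈s
... | inj₂ (ListAny.here eq) = inj₂ eq

∈-late⁻ : ∀ {m} a {k} (es : Vec (Fin m) k) {x} → x ∈ₗ late a es → ∃[ i ] lookup es i ≡ x
∈-late⁻ a {suc k} (e ∷ es) x∈ with k <? a
... | yes k<a = contradiction (subst (_ ∈ₗ_) (late-early (e ∷ es) k<a) x∈) λ ()
... | no k≮a with ∈-∷ʳ⁻ (late a es) (subst (_ ∈ₗ_) (late-∷ e es k≮a) x∈)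
... | inj₁ x∈′ = let i , eq = ∈-late⁻ a es x∈′ in suc i , eq
... | inj₂ eq = zero , sym eq

late-unique : ∀ {m} a {k} {es : Vec (Fin m) k} → Unique es → ListUnique.Unique (late a es)
late-unique a [] = []
late-unique a {suc k} {e ∷ es} (e∉es ∷ uniq) with k <? a
... | yes k<a = subst ListUnique.Unique (sym (late-early (e ∷ es) k<a)) []
... | no k≮a = subst ListUnique.Unique (sym (late-∷ e es k≮a))
  (ListUnique.++⁺ (late-unique a uniq) (ListAll.[] ∷ []) λ where
    (x∈ , ListAny.here refl) → let i , eq = ∈-late⁻ a es x∈ in All.lookup⁺ e∉es i (sym eq))

module _ {m} (M₁ M₂ : Matroid m) (a : ℕ) where

  late-fresh : ∀ {k} {es : Vec (Fin m) k} → Unique es → ∀ {x} → x ∈ₗ late a es → x ∉ Greedy M₁ M₂ a es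
  late-fresh {suc k} {e ∷ es} (e∉es ∷ uniq) {x} x∈ with k <? a
  ... | yes k<a = contradiction (subst (_ ∈ₗ_) (late-early (e ∷ es) k<a) x∈) λ ()
  ... | no k≮a rewrite ≮⇒<ᵇ≡ k≮a with ∈-∷ʳ⁻ (late a es) x∈
  ... | inj₁ x∈′ = late-fresh uniq x∈′
  ... | inj₂ refl = ∉-image e∉es _

  -- The online recursion recomputes `acc` and `kept` at each arrival, while the fold has them fixed
  -- from the start. The two agree because neither changes during the late arrivals.
  run-late : ∀ D {k} (es : Vec (Fin m) k) → let open MarkedGreedy M₁ M₂ a D in
    foldl (Augmentation.step M₁ M₂ (image es (acc es))) (image es (kept es) , image es (acc es)) (late a es)
      ≡ (image es (kept es ∪ aug es) , image es (acc es ∪ aug es))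
  run-late D [] = refl
  run-late D {suc k} (e ∷ es) with k <? a
  ... | yes k<a =
    trans (cong (foldl (Augmentation.step M₁ M₂ (image es′ (acc es′))) (image es′ (kept es′) , image es′ (acc es′)))
            (late-early es′ k<a))
      (sym (cong₂ _,_ (cong (image es′) (none (kept es′))) (cong (image es′) (none (acc es′)))))
    where
    open MarkedGreedy M₁ M₂ a D
    es′ = e ∷ es
    none : ∀ S → S ∪ aug es′ ≡ S
    none S = trans (cong (S ∪_) (augment-early D (observed M₁ es′) (observed M₂ es′) k<a)) (∪-identityʳ S)
  ... | no k≮a rewrite ≮⇒<ᵇ≡ k≮a =
    trans (foldl-∷ʳ step (image es (kept es) , image es (acc es)) e (late a es))
      (trans (cong (λ st → step st e) (run-late D es)) last)
    where
    open MarkedGreedy M₁ M₂ a D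
    open Augmentation M₁ M₂ (image es (acc es))
    last : step (image es (kept es ∪ aug es) , image es (acc es ∪ aug es)) e ≡
           (image (e ∷ es) ((false ∷ kept es) ∪ (candidate e es ∷ aug es)) ,
            image (e ∷ es) ((false ∷ acc es) ∪ (candidate e es ∷ aug es)))
    last with candidate e es
    ... | true  = refl
    ... | false = refl

  module _ {k} {es : Vec (Fin m) k} (uniq : Unique es) {O : Subset m} (O∈I₁ : Independent M₁ O) (O∈I₂ : Independent M₂ O) where

    private
      u = accepted a (observed M₁ es) (observed M₂ es)
      S = image es u
      W = 2 ^ k
      indep = Greedy-independent M₁ M₂ a es

    ∑augment : ℕ
    ∑augment = ∑ₛ k λ v → ∣ augment a (bit v) (observed M₁ es) (observed M₂ es) ∣

    -- This is `sampling` with no coin tossed: `X` is empty, `Y` is `S`, and all of `u` is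
    -- undecided. The initial size of `Y` enters twice on the left and three times on the right,
    -- which leaves the single `W * ∣ u ∣`.
    ∑augment-bound : ∀ {J} → Independent M₂ J →
      (∀ {x} → x ∈ J → x ∈ S ⊎ (x ∈ O × x ∈ₗ late a es × ¬ Independent M₁ (⁅ x ⁆ ∪ S))) →
      W * ∣ J ∣ ≤ W * ∣ u ∣ + 3 * ∑augment
    ∑augment-bound {J} J∈I target = +-cancelʳ-≤ (2 * (W * ∣ u ∣)) _ _ (begin
      W * ∣ J ∣ + 2 * (W * ∣ u ∣)
        ≡⟨ cong (λ x → W * ∣ J ∣ + 2 * (W * x)) (∣image∣ uniq u) ⟨
      W * ∣ J ∣ + 2 * (W * ∣ S ∣)
        ≤⟨ sampling (late a es) ∣ u ∣ ⊥ u S ≤-refl invariant ⟩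
      3 * ∑ₛ k (final (late a es) ⊥ u S) + W * ∣ ⊥ {m} ∣
        ≤⟨ +-mono-≤ (*-monoʳ-≤ 3 (∑ₛ-mono k final≤)) (≤-reflexive (trans (cong (W *_) (∣⊥∣≡0 m)) (*-zeroʳ W))) ⟩
      3 * ∑ₛ k (λ v → ∣ u ∣ + n v) + 0
        ≡⟨ cong (λ x → 3 * x + 0) (trans (∑ₛ-+ k (λ _ → ∣ u ∣) n) (cong (_+ ∑ₛ k n) (∑ₛ-const k ∣ u ∣))) ⟩
      3 * (W * ∣ u ∣ + ∑ₛ k n) + 0
        ≡⟨ lemma (W * ∣ u ∣) (∑ₛ k n) ⟩
      W * ∣ u ∣ + 3 * ∑ₛ k n + 2 * (W * ∣ u ∣) ∎)
      where
      open ≤-Reasoning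
      open Augmentation M₁ M₂ S
      open Sampling (proj₁ indep) J∈I O∈I₁ uniq
      n : Subset k → ℕ
      n v = ∣ augment a (bit v) (observed M₁ es) (observed M₂ es) ∣
      lemma : ∀ x y → 3 * (x + y) + 0 ≡ x + 3 * y + 2 * x
      lemma = solve-∀
      invariant : Invariant ⊥ u S (late a es)
      invariant = record
        { base = subst (Independent M₁) (sym (∪-identityˡ S)) (proj₁ indep)
        ; size = ≤-reflexive (cong ∣_∣ (sym (∪-identityˡ S)))
        ; covered = λ {x} x∈ x∉S → contradiction (subst (x ∈_) (∪-identityˡ S) x∈) x∉S
        ; base⊆Y = λ {x} x∈ → subst (x ∈_) (∪-identityˡ S) x∈
        ; Y∈I = proj₂ indep
        ; fresh = ListAll.tabulate (late-fresh uniq)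
        ; unique = late-unique a uniq
        ; target = λ o∈J → Sum.map (λ o∈S o∉S → contradiction o∈S o∉S) (map₂ inj₂) (target o∈J) }
      final≤ : ∀ v → final (late a es) ⊥ u S v ≤ ∣ u ∣ + n v
      final≤ v = begin
        ∣ proj₂ (foldl step (⊥ ∪ image es (u ∩ v) , S) (late a es)) ∣
          ≡⟨ cong (λ Z → ∣ proj₂ (foldl step (Z , S) (late a es)) ∣)
               (trans (∪-identityˡ _) (cong (λ w → image es (u ∩ w)) (sym (marks-bit v)))) ⟩
        ∣ proj₂ (foldl step (image es (u ∩ marks (bit v) k) , S) (late a es)) ∣
          ≡⟨ cong (∣_∣ ∘ proj₂) (run-late (bit v) es) ⟩
        ∣ image es (u ∪ augment a (bit v) (observed M₁ es) (observed M₂ es)) ∣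
          ≤⟨ ∣image∣≤ es _ ⟩
        ∣ u ∪ augment a (bit v) (observed M₁ es) (observed M₂ es) ∣
          ≤⟨ ∣∪∣≤ u _ ⟩
        ∣ u ∣ + n v ∎

    -- S is extended by optimal elements to an independent set J of the second matroid.
    -- The search competes with J, except for its early elements and those blocked by S in
    -- neither matroid.
    Lost : Subset m → Subset k → Set
    Lost B u = ∀ {x} → x ∈ B → x ∈ O × x ∉ image es u × Independent M₂ (⁅ x ⁆ ∪ image es u) ×
                  (x ∈ₗ late a es → Independent M₁ (⁅ x ⁆ ∪ image es u))

    ∣O∣≤∑augment : ∃[ B ] Lost B u × W * ∣ O ∣ ≤ W * ∣ u ∣ + 3 * ∑augment + W * ∣ B ∣
    ∣O∣≤∑augment
      with J , J∈I , S⊆J , J⊆ , ∣O∣≤∣J∣ ← extend M₂ (proj₂ indep) O∈I₂ = J ∩ ∁ J′ , lost , (let open ≤-Reasoning in begin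
        W * ∣ O ∣                                       ≤⟨ *-monoʳ-≤ W (≤-trans ∣O∣≤∣J∣ (≤-trans (p⊆q⇒∣p∣≤∣q∣ split) (∣∪∣≤ J′ (J ∩ ∁ J′)))) ⟩
        W * (∣ J′ ∣ + ∣ J ∩ ∁ J′ ∣)                     ≡⟨ *-distribˡ-+ W ∣ J′ ∣ _ ⟩
        W * ∣ J′ ∣ + W * ∣ J ∩ ∁ J′ ∣                   ≤⟨ +-monoˡ-≤ _ (∑augment-bound (hereditary M₂ (p∩q⊆p J _) J∈I) target) ⟩
        W * ∣ u ∣ + 3 * ∑augment + W * ∣ J ∩ ∁ J′ ∣     ∎)
      where
      reached? : Decidable (λ x → x ∈ S ⊎ (x ∈ₗ late a es × ¬ Independent M₁ (⁅ x ⁆ ∪ S)))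
      reached? x = x ∈? S ⊎-dec (∈ₗ? _≟_ x (late a es) ×-dec ¬? (independent? M₁ (⁅ x ⁆ ∪ S)))
      J′ = J ∩ select reached?
      split : J ⊆ J′ ∪ (J ∩ ∁ J′)
      split {x} x∈J with x ∈? J′
      ... | yes x∈J′ = p⊆p∪q _ x∈J′
      ... | no x∉J′ = q⊆p∪q J′ _ (x∈p∩q⁺ (x∈J , x∉p⇒x∈∁p x∉J′))
      target : ∀ {x} → x ∈ J′ → x ∈ S ⊎ (x ∈ O × x ∈ₗ late a es × ¬ Independent M₁ (⁅ x ⁆ ∪ S))
      target x∈ with x∈J , x∈s ← x∈p∩q⁻ J _ x∈ with ∈-select⁻ reached? x∈s
      ... | inj₁ x∈S = inj₁ x∈S
      ... | inj₂ r = Sum.map₂ (_, r) (x∈p∪q⁻ S O (J⊆ x∈J))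
      lost : Lost (J ∩ ∁ J′) u
      lost {x} x∈ with x∈J , x∈∁ ← x∈p∩q⁻ J (∁ J′) x∈ =
        [ (λ x∈S → contradiction x∈S x∉S) , id ]′ (x∈p∪q⁻ S O (J⊆ x∈J)) , x∉S ,
        hereditary M₂ (insert-⊆ x∈J S⊆J) J∈I , free
        where
        unreached : ¬ (x ∈ S ⊎ (x ∈ₗ late a es × ¬ Independent M₁ (⁅ x ⁆ ∪ S)))
        unreached r = x∈∁p⇒x∉p x∈∁ (x∈p∩q⁺ (x∈J , ∈-select⁺ reached? r))
        x∉S : x ∉ S
        x∉S = unreached ∘ inj₁
        free : x ∈ₗ late a es → Independent M₁ (⁅ x ⁆ ∪ S)
        free x∈late with independent? M₁ (⁅ x ⁆ ∪ S)
        ... | yes ind = ind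
        ... | no dep = contradiction (inj₂ (x∈late , dep)) unreached

-- Comparison with an optimal set for a fixed arrival order

-- The score of an arrival sees only the element and what came before it. In this form expectations
-- can be compared arrival time by arrival time.
tally : ∀ {m} → (∀ {k} → Vec (Fin m) k → Fin m → ℕ) → ∀ {k} → Vec (Fin m) k → ℕ
tally g []       = 0
tally g (e ∷ es) = g es e + tally g es

module _ {m} (M₁ M₂ : Matroid m) where

  -- At its arrival `x` was tested against a smaller set, so by heredity it would have passed both
  -- tests and been taken.
  Greedy-maximal : ∀ {a k} (es : Vec (Fin m) k) i → k ≤ a → let G = Greedy M₁ M₂ a es ; x = lookup es i in
    Independent M₁ (⁅ x ⁆ ∪ G) → Independent M₂ (⁅ x ⁆ ∪ G) → x ∈ G
  Greedy-maximal {a} (e ∷ es) zero k<a ind₁ ind₂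
    with oracle M₁ (⁅ e ⁆ ∪ Greedy M₁ M₂ a es) ∧ oracle M₂ (⁅ e ⁆ ∪ Greedy M₁ M₂ a es) in eq
  ... | true rewrite <⇒<ᵇ≡ k<a = ∈-insert e _
  ... | false = ⊥-elim (subst T eq (T-∧⁺
    (hereditary M₁ (insert-mono e sub) ind₁)
    (hereditary M₂ (insert-mono e sub) ind₂)))
    where
    sub : Greedy M₁ M₂ a es ⊆ image (e ∷ es) (((_ <ᵇ a) ∧ false) ∷ accepted a (observed M₁ es) (observed M₂ es))
    sub = image-cons (Greedy M₁ M₂ a es ⊆_) e es ((_ <ᵇ a) ∧ false) _ (λ _ → q⊆p∪q ⁅ e ⁆ _) id
  Greedy-maximal {a} (e ∷ es) (suc i) k<a ind₁ ind₂ = Greedy-⊆ M₁ M₂ a e es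
    (Greedy-maximal es i (<⇒≤ k<a)
      (hereditary M₁ (insert-mono _ (Greedy-⊆ M₁ M₂ a e es)) ind₁)
      (hereditary M₂ (insert-mono _ (Greedy-⊆ M₁ M₂ a e es)) ind₂))

  accepted-cutoff : ∀ {a b k} (es : Vec (Fin m) k) → k ≤ a → k ≤ b →
    accepted a (observed M₁ es) (observed M₂ es) ≡ accepted b (observed M₁ es) (observed M₂ es)
  accepted-cutoff [] k≤a k≤b = refl
  accepted-cutoff {a} {b} (e ∷ es) k<a k<b
    rewrite <⇒<ᵇ≡ k<a | <⇒<ᵇ≡ k<b | accepted-cutoff {a} {b} es (<⇒≤ k<a) (<⇒≤ k<b) = refl

  ∣accepted∣-mono : ∀ a {b k} (es : Vec (Fin m) k) → k ≤ b →
    ∣ accepted a (observed M₁ es) (observed M₂ es) ∣ ≤ ∣ accepted b (observed M₁ es) (observed M₂ es) ∣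
  ∣accepted∣-mono a [] k≤b = z≤n
  ∣accepted∣-mono a {b} {suc k} (e ∷ es) k<b with k <? a
  ... | yes k<a = ≤-reflexive (cong ∣_∣ (accepted-cutoff (e ∷ es) k<a k<b))
  ... | no k≮a rewrite ≮⇒<ᵇ≡ k≮a = ≤-trans (∣accepted∣-mono a es (<⇒≤ k<b))
    (∣p∣≤∣x∷p∣ ((k <ᵇ b) ∧ (oracle M₁ (⁅ e ⁆ ∪ image es u) ∧ oracle M₂ (⁅ e ⁆ ∪ image es u))) u)
    where u = accepted b (observed M₁ es) (observed M₂ es)

  module _ (O : Subset m) where

    uncovered : ℕ → ∀ {k} → Vec (Fin m) k → Fin m → Bool
    uncovered a es e = lookup O e ∧
      (oracle M₁ (⁅ e ⁆ ∪ Greedy M₁ M₂ a es) ∧ oracle M₂ (⁅ e ⁆ ∪ Greedy M₁ M₂ a es))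

    lateUncovered earlyOptimal : ℕ → ∀ {k} → Vec (Fin m) k → Fin m → ℕ
    lateUncovered a {k} es e = if k <ᵇ a then 0 else ι (uncovered a es e)
    earlyOptimal a {k} es e = if k <ᵇ a then ι (lookup O e) else 0

    -- If all arrivals belong to the greedy phase, this is the event that greedy picks the arriving
    -- element and that it is optimal. With a cutoff `a` it is only the event that an optimal
    -- element is not blocked by the set frozen after `a` arrivals.
    greedyOptimal : ℕ → ∀ {k} → Vec (Fin m) k → Fin m → ℕ
    greedyOptimal a es e = ι (uncovered a es e)

    tally-greedyOptimal : ∀ {a k} {es : Vec (Fin m) k} → Unique es → k ≤ a →
      tally (greedyOptimal a) es ≤ ∣ O ∩ Greedy M₁ M₂ a es ∣
    tally-greedyOptimal [] k≤a = z≤n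
    tally-greedyOptimal {a} {suc k} {e ∷ es} (e∉es ∷ uniq) k<a
      with ih ← tally-greedyOptimal uniq (<⇒≤ k<a)
      with lookup O e in eq
    ... | false = ≤-trans ih (p⊆q⇒∣p∣≤∣q∣ {p = O ∩ Greedy M₁ M₂ a es} {O ∩ Greedy M₁ M₂ a (e ∷ es)} λ x∈ →
      let x∈O , x∈G = x∈p∩q⁻ O _ x∈ in x∈p∩q⁺ (x∈O , Greedy-⊆ M₁ M₂ a e es x∈G))
    ... | true rewrite <⇒<ᵇ≡ k<a
      with oracle M₁ (⁅ e ⁆ ∪ Greedy M₁ M₂ a es) ∧ oracle M₂ (⁅ e ⁆ ∪ Greedy M₁ M₂ a es)
    ... | false = ih
    ... | true = ≤-trans (s≤s ih) (≤-trans
      (≤-reflexive (sym (∣insert∣ {S = O ∩ G} λ e∈ → ∉-image e∉es _ (proj₂ (x∈p∩q⁻ O G e∈)))))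
      (p⊆q⇒∣p∣≤∣q∣ (insert-⊆ (x∈p∩q⁺ (lookup⇒[]= e O eq , ∈-insert e G)) λ x∈ →
        let x∈O , x∈G = x∈p∩q⁻ O G x∈ in x∈p∩q⁺ (x∈O , q⊆p∪q ⁅ e ⁆ G x∈G))))
      where G = Greedy M₁ M₂ a es

    -- By maximality every optimal element is covered by `G` in at least one matroid. Those inside
    -- `G` are covered in both and hence counted twice, which sharpens the usual factor one half.
    greedy-bound : ∀ {a k} {es : Vec (Fin m) k} → CommonIndependent M₁ M₂ O → Unique es → k ≤ a →
      (∀ x → ∃[ i ] lookup es i ≡ x) →
      ∣ O ∣ + tally (greedyOptimal a) es ≤ 2 * ∣ accepted a (observed M₁ es) (observed M₂ es) ∣
    greedy-bound {a} {k} {es} (O∈I₁ , O∈I₂) uniq k≤a surj = begin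
      ∣ O ∣ + tally (greedyOptimal a) es ≤⟨ +-mono-≤ (p⊆q⇒∣p∣≤∣q∣ O⊆) (≤-trans (tally-greedyOptimal uniq k≤a) (p⊆q⇒∣p∣≤∣q∣ O∩G⊆)) ⟩
      ∣ O₁ ∪ O₂ ∣ + ∣ O₁ ∩ O₂ ∣          ≡⟨ ∣∪∣+∣∩∣ O₁ O₂ ⟩
      ∣ O₁ ∣ + ∣ O₂ ∣                    ≤⟨ +-mono-≤
        (covered-∣∣≤ M₁ (hereditary M₁ (p∩q⊆p O _) O∈I₁) (proj₁ indep) (∈-select⁻ (covered? M₁ G) ∘ p∩q⊆q O _))
        (covered-∣∣≤ M₂ (hereditary M₂ (p∩q⊆p O _) O∈I₂) (proj₂ indep) (∈-select⁻ (covered? M₂ G) ∘ p∩q⊆q O _)) ⟩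
      ∣ G ∣ + ∣ G ∣                      ≡⟨ cong₂ _+_ (∣image∣ uniq u) (trans (∣image∣ uniq u) (sym (+-identityʳ _))) ⟩
      2 * ∣ u ∣                          ∎
      where
      open ≤-Reasoning
      u = accepted a (observed M₁ es) (observed M₂ es)
      G = image es u
      indep = Greedy-independent M₁ M₂ a es
      O₁ = O ∩ select (covered? M₁ G)
      O₂ = O ∩ select (covered? M₂ G)
      O⊆ : O ⊆ O₁ ∪ O₂
      O⊆ {x} x∈O with covered? M₁ G x | covered? M₂ G x
      ... | yes c₁ | _ = p⊆p∪q O₂ (x∈p∩q⁺ (x∈O , ∈-select⁺ (covered? M₁ G) c₁))
      ... | no _ | yes c₂ = q⊆p∪q O₁ O₂ (x∈p∩q⁺ (x∈O , ∈-select⁺ (covered? M₂ G) c₂))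
      ... | no ¬c₁ | no ¬c₂ = ⊥-elim (¬c₁ λ x∉G ind₁ → ¬c₂ λ _ ind₂ → x∉G (maximal ind₁ ind₂))
        where
        maximal : Independent M₁ (⁅ x ⁆ ∪ G) → Independent M₂ (⁅ x ⁆ ∪ G) → x ∈ G
        maximal with i , refl ← surj x = Greedy-maximal es i k≤a
      O∩G⊆ : O ∩ G ⊆ O₁ ∩ O₂
      O∩G⊆ x∈ = let x∈O , x∈G = x∈p∩q⁻ O G x∈ in x∈p∩q⁺
        ( x∈p∩q⁺ (x∈O , ∈-select⁺ (covered? M₁ G) (contradiction x∈G))
        , x∈p∩q⁺ (x∈O , ∈-select⁺ (covered? M₂ G) (contradiction x∈G)) )

    module _ (a : ℕ) {S B₁ B₂ : Subset m} where

      -- A late lost element fits `S` in both matroids; it may be lost to both searches, hence the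
      -- factor two. An early one cannot be lost to both, for then it would fit `S` in both matroids
      -- and greedy would have taken it. `S` stays fixed while the induction passes to shorter
      -- histories, whose greedy sets are contained in it.
      lost-bound : ∀ {k} (es : Vec (Fin m) k) → Greedy M₁ M₂ a es ⊆ S →
        (∀ {x} → x ∈ B₁ → x ∈ O × x ∉ S × Independent M₂ (⁅ x ⁆ ∪ S) × (x ∈ₗ late a es → Independent M₁ (⁅ x ⁆ ∪ S))) →
        (∀ {x} → x ∈ B₂ → x ∈ O × x ∉ S × Independent M₁ (⁅ x ⁆ ∪ S) × (x ∈ₗ late a es → Independent M₂ (⁅ x ⁆ ∪ S))) →
        count B₁ es + count B₂ es ≤ 2 * tally (lateUncovered a) es + tally (earlyOptimal a) es
      lost-bound [] G⊆S lost₁ lost₂ = z≤n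
      lost-bound {suc k} (e ∷ es) G⊆S lost₁ lost₂ = begin
        count B₁ (e ∷ es) + count B₂ (e ∷ es)
          ≡⟨ cong₂ _+_ (∣∷∣ (lookup B₁ e) (map (lookup B₁) es)) (∣∷∣ (lookup B₂ e) (map (lookup B₂) es)) ⟩
        (ι b₁ + count B₁ es) + (ι b₂ + count B₂ es)
          ≡⟨ +-interchange (ι b₁) (count B₁ es) (ι b₂) (count B₂ es) ⟩
        (ι b₁ + ι b₂) + (count B₁ es + count B₂ es)
          ≤⟨ +-mono-≤ bits (lost-bound es (G⊆S ∘ Greedy-⊆ M₁ M₂ a e es)
               (map₂ (map₂ (map₂ (_∘ late-⊆))) ∘ lost₁) (map₂ (map₂ (map₂ (_∘ late-⊆))) ∘ lost₂)) ⟩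
        (2 * lateUncovered a es e + earlyOptimal a es e) + (2 * tally (lateUncovered a) es + tally (earlyOptimal a) es)
          ≡⟨ lemma (lateUncovered a es e) (earlyOptimal a es e) (tally (lateUncovered a) es) (tally (earlyOptimal a) es) ⟩
        2 * tally (lateUncovered a) (e ∷ es) + tally (earlyOptimal a) (e ∷ es) ∎
        where
        open ≤-Reasoning
        b₁ = lookup B₁ e
        b₂ = lookup B₂ e
        lemma : ∀ c d x y → (2 * c + d) + (2 * x + y) ≡ 2 * (c + x) + (d + y)
        lemma = solve-∀
        late-⊆ : ∀ {x} → x ∈ₗ late a es → x ∈ₗ late a (e ∷ es)
        late-⊆ {x} x∈ with k <? a
        ... | yes k<a = contradiction (subst (x ∈ₗ_) (late-early es (<⇒≤ k<a)) x∈) λ ()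
        ... | no k≮a = subst (x ∈ₗ_) (sym (late-∷ e es k≮a)) (∈-++⁺ˡ x∈)
        bits : ι b₁ + ι b₂ ≤ 2 * lateUncovered a es e + earlyOptimal a es e
        bits with k <? a
        bits | yes k<a = ≤-trans early-bits (≤-reflexive (sym reduce))
          where
          reduce : 2 * lateUncovered a es e + earlyOptimal a es e ≡ ι (lookup O e)
          reduce rewrite <⇒<ᵇ≡ k<a = refl
          early-bits : ι b₁ + ι b₂ ≤ ι (lookup O e)
          early-bits with lookup B₁ e in eq₁ | lookup B₂ e in eq₂
          ... | false | false = z≤n
          ... | true | false rewrite []=⇒lookup (proj₁ (lost₁ (lookup⇒[]= e B₁ eq₁))) = ≤-refl
          ... | false | true rewrite []=⇒lookup (proj₁ (lost₂ (lookup⇒[]= e B₂ eq₂))) = ≤-refl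
          ... | true | true with lost₁ (lookup⇒[]= e B₁ eq₁) | lost₂ (lookup⇒[]= e B₂ eq₂)
          ... | _ , e∉S , ind₂ , _ | _ , _ , ind₁ , _ = ⊥-elim (e∉S (G⊆S (Greedy-maximal {a} (e ∷ es) zero k<a
                (hereditary M₁ (insert-mono e G⊆S) ind₁) (hereditary M₂ (insert-mono e G⊆S) ind₂))))
        bits | no k≮a = ≤-trans (+-mono-≤ (bit≤ b₁ one) (bit≤ b₂ two))
            (≤-reflexive (trans (dbl (ι (uncovered a es e))) (sym reduce)))
          where
          reduce : 2 * lateUncovered a es e + earlyOptimal a es e ≡ 2 * ι (uncovered a es e) + 0
          reduce rewrite ≮⇒<ᵇ≡ k≮a = refl
          dbl : ∀ x → x + x ≡ 2 * x + 0
          dbl = solve-∀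
          bit≤ : ∀ b → (b ≡ true → T (uncovered a es e)) → ι b ≤ ι (uncovered a es e)
          bit≤ false f = z≤n
          bit≤ true f with uncovered a es e | f refl
          ... | true | _ = ≤-refl
          G⊆ : Greedy M₁ M₂ a es ⊆ S
          G⊆ = G⊆S ∘ Greedy-⊆ M₁ M₂ a e es
          e∈late : e ∈ₗ late a (e ∷ es)
          e∈late = subst (e ∈ₗ_) (sym (late-∷ e es k≮a)) (∈-++⁺ʳ (late a es) (ListAny.here refl))
          witness : e ∈ O → Independent M₁ (⁅ e ⁆ ∪ S) → Independent M₂ (⁅ e ⁆ ∪ S) → T (uncovered a es e)
          witness e∈O ind₁ ind₂ = T-∧⁺ (Equivalence.from T-≡ ([]=⇒lookup e∈O))
            (T-∧⁺ (hereditary M₁ (insert-mono e G⊆) ind₁) (hereditary M₂ (insert-mono e G⊆) ind₂))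
          one : b₁ ≡ true → T (uncovered a es e)
          one eq with e∈O , _ , ind₂ , free ← lost₁ (lookup⇒[]= e B₁ eq) = witness e∈O (free e∈late) ind₂
          two : b₂ ≡ true → T (uncovered a es e)
          two eq with e∈O , _ , ind₁ , free ← lost₂ (lookup⇒[]= e B₂ eq) = witness e∈O ind₁ (free e∈late)

-- Size of the marked greedy solution for a fixed order

module _ {m} (M₁ M₂ : Matroid m) (a : ℕ) where

  -- Each search picks only elements that depend on `acc` in its own matroid. Kept elements belong
  -- to `acc`, and the picks of the other search are independent over `acc` in that matroid, so the
  -- three parts are disjoint.
  ∣marked-greedy∣ : ∀ D {k} (es : Vec (Fin m) k) →
    ∣ marked-greedy a D (observed M₁ es) (observed M₂ es) ∣ ≡
    ∣ accepted a (observed M₁ es) (observed M₂ es) ∩ marks D k ∣ +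
    (∣ augment a D (observed M₁ es) (observed M₂ es) ∣ + ∣ augment a D (observed M₂ es) (observed M₁ es) ∣)
  ∣marked-greedy∣ D {k} es = trans (∣∪∣-disjoint kept-fresh) (cong (∣ A.kept es ∣ +_) (∣∪∣-disjoint disjoint))
    where
    module A = MarkedGreedy M₁ M₂ a D
    module B = MarkedGreedy M₂ M₁ a D
    indep = Greedy-independent M₁ M₂ a es
    acc≡ : B.acc es ≡ A.acc es
    acc≡ = accepted-comm a (observed M₂ es) (observed M₁ es)
    kept-fresh : ∀ {i} → i ∈ A.kept es → i ∉ A.aug es ∪ B.aug es
    kept-fresh {i} i∈kept i∈ with x∈p∪q⁻ (A.aug es) (B.aug es) i∈
    ... | inj₁ i∈A = A.aug-dependent es (∈-image⁺ es i∈A)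
      (hereditary M₁ (insert-⊆ (∈-image⁺ es (p∩q⊆p (A.acc es) (marks D k) i∈kept)) id) (proj₁ indep))
    ... | inj₂ i∈B = B.aug-dependent es (∈-image⁺ es i∈B)
      (hereditary M₂ (insert-⊆ (∈-image⁺ es (p∩q⊆p (A.acc es) (marks D k) i∈kept)) (⊆-reflexive (cong (image es) acc≡))) (proj₂ indep))
    disjoint : ∀ {i} → i ∈ A.aug es → i ∉ B.aug es
    disjoint i∈A i∈B = A.aug-dependent es (∈-image⁺ es i∈A) (hereditary M₁ (insert-⊆
      (∈-image⁺ es (q⊆p∪q (B.acc es) (B.aug es) i∈B))
      (image-mono es (p⊆p∪q (B.aug es)) ∘ ⊆-reflexive (cong (image es) (sym acc≡))))
      (proj₂ (B.kept∪aug-independent es)))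

  -- The bounds for the two searches are added and doubled, which produces four times the size of
  -- the first-phase solution. Six times its kept half accounts for three of these, and one remains
  -- on the right.
  marked-greedy-bound : ∀ {O k} {es : Vec (Fin m) k} → CommonIndependent M₁ M₂ O → Unique es →
    (∀ x → ∃[ i ] lookup es i ≡ x) → let W = 2 ^ k in
    4 * (W * ∣ O ∣) ≤
    6 * ∑ₛ k (λ v → ∣ marked-greedy a (bit v) (observed M₁ es) (observed M₂ es) ∣) +
    W * ∣ accepted a (observed M₁ es) (observed M₂ es) ∣ +
    4 * (W * tally (lateUncovered M₁ M₂ O a) es) + 2 * (W * tally (earlyOptimal M₁ M₂ O a) es)
  marked-greedy-bound {O} {k} {es} (O∈I₁ , O∈I₂) uniq surj
    with B₁ , lost₁ , bound₁ ← ∣O∣≤∑augment M₁ M₂ a uniq O∈I₁ O∈I₂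
    with B₂ , lost₂ , bound₂ ← ∣O∣≤∑augment M₂ M₁ a uniq O∈I₂ O∈I₁
    = begin
    4 * (W * ∣ O ∣)
      ≡⟨ split (W * ∣ O ∣) ⟩
    2 * (W * ∣ O ∣ + W * ∣ O ∣)
      ≤⟨ *-monoʳ-≤ 2 (+-mono-≤ (bound′ {n₁} B₁ bound₁) (bound′ {n₂} B₂ (subst (λ u → W * ∣ O ∣ ≤ W * ∣ u ∣ + 3 * n₂ + W * ∣ B₂ ∣) acc≡ bound₂))) ⟩
    2 * ((W * t + 3 * n₁ + W * count B₁ es) + (W * t + 3 * n₂ + W * count B₂ es))
      ≡⟨ regroup (W * t) n₁ n₂ W (count B₁ es) (count B₂ es) ⟩
    4 * (W * t) + 6 * (n₁ + n₂) + 2 * (W * (count B₁ es + count B₂ es))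
      ≤⟨ +-monoʳ-≤ (4 * (W * t) + 6 * (n₁ + n₂)) (*-monoʳ-≤ 2 (*-monoʳ-≤ W (lost-bound M₁ M₂ O a {S = image es u} es id lost₁
           (subst (Lost M₂ M₁ a uniq O∈I₂ O∈I₁ B₂) acc≡ lost₂)))) ⟩
    4 * (W * t) + 6 * (n₁ + n₂) + 2 * (W * (2 * c + d))
      ≡⟨ regroup′ W (W * t) (n₁ + n₂) c d ⟩
    3 * (W * t) + 6 * (n₁ + n₂) + W * t + 4 * (W * c) + 2 * (W * d)
      ≡⟨ cong (λ x → 3 * x + 6 * (n₁ + n₂) + W * t + 4 * (W * c) + 2 * (W * d)) (∑ₛ-∣∩∣ u) ⟨
    3 * (2 * s) + 6 * (n₁ + n₂) + W * t + 4 * (W * c) + 2 * (W * d)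
      ≡⟨ cong (λ x → x + W * t + 4 * (W * c) + 2 * (W * d)) (trans (regroup″ s (n₁ + n₂)) (cong (6 *_) (sym total))) ⟩
    6 * p + W * t + 4 * (W * c) + 2 * (W * d) ∎
    where
    open ≤-Reasoning
    W = 2 ^ k
    u = accepted a (observed M₁ es) (observed M₂ es)
    t = ∣ u ∣
    n₁ = ∑augment M₁ M₂ a uniq O∈I₁ O∈I₂
    n₂ = ∑augment M₂ M₁ a uniq O∈I₂ O∈I₁
    c = tally (lateUncovered M₁ M₂ O a) es
    d = tally (earlyOptimal M₁ M₂ O a) es
    s = ∑ₛ k (λ v → ∣ u ∩ v ∣)
    p = ∑ₛ k (λ v → ∣ marked-greedy a (bit v) (observed M₁ es) (observed M₂ es) ∣)
    acc≡ : accepted a (observed M₂ es) (observed M₁ es) ≡ u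
    acc≡ = accepted-comm a (observed M₂ es) (observed M₁ es)
    bound′ : ∀ {n} B → W * ∣ O ∣ ≤ W * t + 3 * n + W * ∣ B ∣ → W * ∣ O ∣ ≤ W * t + 3 * n + W * count B es
    bound′ {n} B le = ≤-trans le (+-monoʳ-≤ (W * t + 3 * n) (*-monoʳ-≤ W (∣∣≤count {es = es} {B} λ {x} _ → surj x)))
    total : p ≡ s + (n₁ + n₂)
    total = trans (∑ₛ-cong k λ v → trans (∣marked-greedy∣ (bit v) es)
        (cong (λ w → ∣ u ∩ w ∣ + (∣ augment a (bit v) (observed M₁ es) (observed M₂ es) ∣ + ∣ augment a (bit v) (observed M₂ es) (observed M₁ es) ∣)) (marks-bit v)))
      (trans (∑ₛ-+ k (λ v → ∣ u ∩ v ∣) _) (cong (s +_) (∑ₛ-+ k _ _)))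
    split : ∀ x → 4 * x ≡ 2 * (x + x)
    split = solve-∀
    regroup : ∀ t x y w b c → 2 * ((t + 3 * x + w * b) + (t + 3 * y + w * c)) ≡ 4 * t + 6 * (x + y) + 2 * (w * (b + c))
    regroup = solve-∀
    regroup′ : ∀ w t n c d → 4 * t + 6 * n + 2 * (w * (2 * c + d)) ≡ 3 * t + 6 * n + t + 4 * (w * c) + 2 * (w * d)
    regroup′ = solve-∀
    regroup″ : ∀ s n → 3 * (2 * s) + 6 * n ≡ 6 * (s + n)
    regroup″ = solve-∀

-- Uniformly random arrival order

sum-mono : ∀ {n} {f g : Fin n → ℕ} → (∀ i → f i ≤ g i) → sum f ≤ sum g
sum-mono {zero}  f≤g = z≤n
sum-mono {suc n} f≤g = +-mono-≤ (f≤g zero) (sum-mono (f≤g ∘ suc))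

apart : ∀ {m} → Fin m → Fin m → ℕ
apart i j = if does (i ≟ j) then 0 else 1

apart-refl : ∀ {m} (i : Fin m) → apart i i ≡ 0
apart-refl i = cong (if_then 0 else 1) (dec-true (i ≟ i) refl)

apart-≢ : ∀ {m} {i j : Fin m} → i ≢ j → apart i j ≡ 1
apart-≢ {i = i} {j} i≢j = cong (if_then 0 else 1) (dec-false (i ≟ j) i≢j)

apart-sym : ∀ {m} (i j : Fin m) → apart i j ≡ apart j i
apart-sym i j with i ≟ j
... | yes refl = sym (apart-refl i)
... | no i≢j = sym (apart-≢ (i≢j ∘ sym))

apart-punchIn : ∀ {m} (k : Fin (suc m)) i j → apart (punchIn k i) (punchIn k j) ≡ apart i j
apart-punchIn k i j with i ≟ j
... | yes refl = apart-refl (punchIn k i)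
... | no i≢j = apart-≢ (i≢j ∘ punchIn-injective k i j)

fresh : ∀ {m n} → Fin m → Vec (Fin m) n → ℕ
fresh i []       = 1
fresh i (j ∷ es) = apart i j * fresh i es

-- The sum over all repetition-free vectors.
∑ᵤ : ∀ {m} n → (Vec (Fin m) n → ℕ) → ℕ
∑ᵤ zero    F = F []
∑ᵤ (suc n) F = sum λ i → ∑ᵤ n λ es → fresh i es * F (i ∷ es)

∑ᵤ-mono : ∀ {m} n {F G : Vec (Fin m) n → ℕ} → (∀ es → F es ≤ G es) → ∑ᵤ n F ≤ ∑ᵤ n G
∑ᵤ-mono zero    F≤G = F≤G []
∑ᵤ-mono (suc n) F≤G = sum-mono λ i → ∑ᵤ-mono n λ es → *-monoʳ-≤ (fresh i es) (F≤G (i ∷ es))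

∑ᵤ-cong : ∀ {m} n {F G : Vec (Fin m) n → ℕ} → (∀ es → F es ≡ G es) → ∑ᵤ n F ≡ ∑ᵤ n G
∑ᵤ-cong n F≡G = ≤-antisym (∑ᵤ-mono n (≤-reflexive ∘ F≡G)) (∑ᵤ-mono n (≤-reflexive ∘ sym ∘ F≡G))

∑ᵤ-* : ∀ {m} n c (F : Vec (Fin m) n → ℕ) → ∑ᵤ n (λ es → c * F es) ≡ c * ∑ᵤ n F
∑ᵤ-* zero    c F = refl
∑ᵤ-* (suc n) c F = trans
  (sum-cong-≗ λ i → trans (∑ᵤ-cong n λ es → swap* (fresh i es) c (F (i ∷ es))) (∑ᵤ-* n c λ es → fresh i es * F (i ∷ es)))
  (sym (*-distribˡ-sum c λ i → ∑ᵤ n λ es → fresh i es * F (i ∷ es)))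
  where
  swap* : ∀ a b c → a * (b * c) ≡ b * (a * c)
  swap* = solve-∀

∑ᵤ-+ : ∀ {m} n (F G : Vec (Fin m) n → ℕ) → ∑ᵤ n (λ es → F es + G es) ≡ ∑ᵤ n F + ∑ᵤ n G
∑ᵤ-+ zero    F G = refl
∑ᵤ-+ (suc n) F G = trans
  (sum-cong-≗ λ i → trans (∑ᵤ-cong n λ es → *-distribˡ-+ (fresh i es) (F (i ∷ es)) (G (i ∷ es)))
    (∑ᵤ-+ n (λ es → fresh i es * F (i ∷ es)) (λ es → fresh i es * G (i ∷ es))))
  (∑-distrib-+ (λ i → ∑ᵤ n λ es → fresh i es * F (i ∷ es)) (λ i → ∑ᵤ n λ es → fresh i es * G (i ∷ es)))

fresh-punchIn : ∀ {m n} (k : Fin (suc m)) i (es : Vec (Fin m) n) →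
  fresh (punchIn k i) (map (punchIn k) es) ≡ fresh i es
fresh-punchIn k i []       = refl
fresh-punchIn k i (j ∷ es) = cong₂ _*_ (apart-punchIn k i j) (fresh-punchIn k i es)

-- Vectors that avoid `k` are relabelled vectors over a ground set with one element less. This
-- matches the recursion by which `permutations` is built.
∑ᵤ-punchIn : ∀ {m} n k (F : Vec (Fin (suc m)) n → ℕ) →
  ∑ᵤ n (λ es → fresh k es * F es) ≡ ∑ᵤ n (F ∘ map (punchIn k))
∑ᵤ-punchIn zero    k F = *-identityˡ _
∑ᵤ-punchIn (suc n) k F = begin
  sum (λ i → ∑ᵤ n λ es → fresh i es * (apart k i * fresh k es * F (i ∷ es)))
    ≡⟨ sum-cong-≗ (λ i → trans (∑ᵤ-cong n λ es → regroup (fresh i es) (apart k i) (fresh k es) (F (i ∷ es)))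
         (∑ᵤ-* n (apart k i) λ es → fresh k es * (fresh i es * F (i ∷ es)))) ⟩
  sum (λ i → apart k i * ∑ᵤ n λ es → fresh k es * (fresh i es * F (i ∷ es)))
    ≡⟨ sum-cong-≗ (λ i → cong (apart k i *_) (∑ᵤ-punchIn n k λ es → fresh i es * F (i ∷ es))) ⟩
  sum (λ i → apart k i * G i)
    ≡⟨ sum-remove {i = k} (λ i → apart k i * G i) ⟩
  apart k k * G k + sum (λ i → apart k (punchIn k i) * G (punchIn k i))
    ≡⟨ cong₂ _+_ (cong (_* G k) (apart-refl k))
         (sum-cong-≗ λ i → trans (cong (_* G (punchIn k i)) (apart-≢ (punchInᵢ≢i k i ∘ sym))) (+-identityʳ _)) ⟩
  sum (λ i → G (punchIn k i))
    ≡⟨ sum-cong-≗ (λ i → ∑ᵤ-cong n λ es → cong (_* F (punchIn k i ∷ map (punchIn k) es)) (fresh-punchIn k i es)) ⟩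
  sum (λ i → ∑ᵤ n λ es → fresh i es * F (map (punchIn k) (i ∷ es))) ∎
  where
  open ≡-Reasoning
  G : Fin _ → ℕ
  G i = ∑ᵤ n λ es → fresh i (map (punchIn k) es) * F (i ∷ map (punchIn k) es)
  regroup : ∀ a b c d → a * (b * c * d) ≡ b * (c * (a * d))
  regroup = solve-∀

vsum-concat-map : ∀ {a b} {A : Set a} {B : Set b} {k n} (f : A → ℕ) (g : B → Vec A k) (xs : Vec B n) →
  vsum (map f (concat (map g xs))) ≡ vsum (map (λ x → vsum (map f (g x))) xs)
vsum-concat-map f g []       = refl
vsum-concat-map f g (x ∷ xs) = trans (cong vsum (map-++ f (g x) (concat (map g xs))))
  (trans (sum-++ (map f (g x))) (cong (vsum (map f (g x)) +_) (vsum-concat-map f g xs)))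

vsum-tabulate : ∀ {n} (f : Fin n → ℕ) → vsum (tabulate f) ≡ sum f
vsum-tabulate {zero}  f = refl
vsum-tabulate {suc n} f = cong (f zero +_) (vsum-tabulate (f ∘ suc))

∑ₕ : ∀ {m} → (Vec (Fin m) m → ℕ) → ℕ
∑ₕ {m} F = vsum (map (F ∘ history) (permutations m))

history-insert : ∀ {n} j (ρ : Permutation′ n) → history (Perm.insert zero j ρ) ≡ j ∷ map (punchIn j) (history ρ)
history-insert j ρ = cong (j ∷_) (trans (tabulate-cong (Perm.insert-punchIn zero j ρ)) (tabulate-∘ (punchIn j) _))

-- The enumeration by insertion hides the symmetry between arrival times; the sum over
-- repetition-free vectors makes it accessible.
∑ₕ≡∑ᵤ : ∀ {m} (F : Vec (Fin m) m → ℕ) → ∑ₕ F ≡ ∑ᵤ m F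
∑ₕ≡∑ᵤ {zero}  F = +-identityʳ (F [])
∑ₕ≡∑ᵤ {suc m} F = begin
  vsum (map f (concat (map extensions (allFin (suc m)))))
    ≡⟨ vsum-concat-map f extensions (allFin (suc m)) ⟩
  vsum (map (λ j → vsum (map f (extensions j))) (allFin (suc m)))
    ≡⟨ cong vsum (tabulate-allFin λ j → vsum (map f (extensions j))) ⟨
  vsum (tabulate λ j → vsum (map f (extensions j)))
    ≡⟨ vsum-tabulate (λ j → vsum (map f (extensions j))) ⟩
  sum (λ j → vsum (map f (extensions j)))
    ≡⟨ sum-cong-≗ (λ j → cong vsum (trans (sym (map-∘ f (Perm.insert zero j) (permutations m)))
         (map-cong (λ ρ → cong F (history-insert j ρ)) (permutations m)))) ⟩
  sum (λ j → ∑ₕ λ es → F (j ∷ map (punchIn j) es))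
    ≡⟨ sum-cong-≗ (λ j → trans (∑ₕ≡∑ᵤ (λ es → F (j ∷ map (punchIn j) es))) (sym (∑ᵤ-punchIn m j (F ∘ (j ∷_))))) ⟩
  ∑ᵤ (suc m) F ∎
  where
  open ≡-Reasoning
  f = F ∘ history
  extensions : Fin (suc m) → Vec (Permutation′ (suc m)) (m !)
  extensions j = map (Perm.insert zero j) (permutations m)

-- Exchangeability of arrival times

swap : ∀ {a} {A : Set a} {n} → ℕ → Vec A n → Vec A n
swap d       []           = []
swap zero    (x ∷ [])     = x ∷ []
swap zero    (x ∷ y ∷ xs) = y ∷ x ∷ xs
swap (suc d) (x ∷ xs)     = x ∷ swap d xs

fresh-swap : ∀ {m n} d i (es : Vec (Fin m) n) → fresh i (swap d es) ≡ fresh i es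
fresh-swap d       i []           = refl
fresh-swap zero    i (x ∷ [])     = refl
fresh-swap zero    i (x ∷ y ∷ es) = lemma (apart i y) (apart i x) (fresh i es)
  where
  lemma : ∀ a b c → a * (b * c) ≡ b * (a * c)
  lemma = solve-∀
fresh-swap (suc d) i (x ∷ es)     = cong (apart i x *_) (fresh-swap d i es)

-- Invariance of the uniform order under adjacent transpositions: all comparisons between arrival
-- times are derived from it.
∑ᵤ-swap : ∀ {m} n d (F : Vec (Fin m) n → ℕ) → ∑ᵤ n F ≡ ∑ᵤ n (F ∘ swap d)
∑ᵤ-swap zero          d       F = refl
∑ᵤ-swap (suc zero)    zero    F = refl
∑ᵤ-swap (suc (suc n)) zero    F = trans
  (∑-comm λ i j → ∑ᵤ n λ es → fresh j es * (apart i j * fresh i es * F (i ∷ j ∷ es)))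
  (sum-cong-≗ λ j → sum-cong-≗ λ i → ∑ᵤ-cong n λ es →
    trans (cong (λ x → fresh j es * (x * fresh i es * F (i ∷ j ∷ es))) (apart-sym i j))
      (lemma (fresh j es) (apart j i) (fresh i es) (F (i ∷ j ∷ es))))
  where
  lemma : ∀ a b c d → a * (b * c * d) ≡ c * (b * a * d)
  lemma = solve-∀
∑ᵤ-swap (suc n) (suc d) F = sum-cong-≗ λ i → trans (∑ᵤ-swap n d λ es → fresh i es * F (i ∷ es))
  (∑ᵤ-cong n λ es → cong (_* F (i ∷ swap d es)) (fresh-swap d i es))

Score : ℕ → Set
Score m = ∀ {k} → Vec (Fin m) k → Fin m → ℕ

-- Depth zero is the latest arrival; beyond the first arrival the score is zero.
at : ∀ {m} → Score m → ℕ → ∀ {n} → Vec (Fin m) n → ℕ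
at g d       []       = 0
at g zero    (e ∷ es) = g es e
at g (suc d) (e ∷ es) = at g d es

∑< : ℕ → (ℕ → ℕ) → ℕ
∑< zero    f = 0
∑< (suc n) f = f 0 + ∑< n (f ∘ suc)

∑<-cong : ∀ n {f g : ℕ → ℕ} → (∀ d → f d ≡ g d) → ∑< n f ≡ ∑< n g
∑<-cong zero    f≡g = refl
∑<-cong (suc n) f≡g = cong₂ _+_ (f≡g 0) (∑<-cong n (f≡g ∘ suc))

∑<-≤ : ∀ n {f : ℕ → ℕ} {c} → (∀ {d} → d < n → f d ≤ c) → ∑< n f ≤ n * c
∑<-≤ zero    f≤c = z≤n
∑<-≤ (suc n) f≤c = +-mono-≤ (f≤c (s≤s z≤n)) (∑<-≤ n (f≤c ∘ s≤s))

∑<-≥ : ∀ n {f : ℕ → ℕ} {c} → (∀ {d} → d < n → c ≤ f d) → n * c ≤ ∑< n f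
∑<-≥ zero    c≤f = z≤n
∑<-≥ (suc n) c≤f = +-mono-≤ (c≤f (s≤s z≤n)) (∑<-≥ n (c≤f ∘ s≤s))

∑<-+ : ∀ p q f → ∑< (p + q) f ≡ ∑< p f + ∑< q (f ∘ (p +_))
∑<-+ zero    q f = refl
∑<-+ (suc p) q f = trans (cong (f 0 +_) (∑<-+ p q (f ∘ suc))) (sym (+-assoc (f 0) _ _))

tally-at : ∀ {m} (g : Score m) {n} (es : Vec (Fin m) n) → tally g es ≡ ∑< n (λ d → at g d es)
tally-at g []       = refl
tally-at g (e ∷ es) = cong (g es e +_) (tally-at g es)

∑ᵤ-∑< : ∀ {m} n p (F : ℕ → Vec (Fin m) n → ℕ) → ∑ᵤ n (λ es → ∑< p λ d → F d es) ≡ ∑< p (λ d → ∑ᵤ n (F d))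
∑ᵤ-∑< n zero    F = ∑ᵤ-* n 0 λ _ → 0
∑ᵤ-∑< n (suc p) F = trans (∑ᵤ-+ n (F 0) _) (cong (∑ᵤ n (F 0) +_) (∑ᵤ-∑< n p (F ∘ suc)))

at-cong : ∀ {m} (R : ℕ → ℕ → Set) {g h : Score m} d {n} (es : Vec (Fin m) n) → R 0 0 →
  (∀ {k} (es : Vec (Fin m) k) e → n ≡ d + suc k → R (g es e) (h es e)) → R (at g d es) (at h d es)
at-cong R d       []       R0 r = R0
at-cong R zero    (e ∷ es) R0 r = r es e refl
at-cong R (suc d) (e ∷ es) R0 r = at-cong R d es R0 λ es′ e′ eq → r es′ e′ (cong suc eq)

-- After the swap the same element arrives one step earlier and has one predecessor less. `R` is
-- instantiated with `_≤_` for monotone scores and with `_≡_` for scores that ignore the history.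
at-swap : ∀ {m} (R : ℕ → ℕ → Set) {g h : Score m} → (∀ {k} (es : Vec (Fin m) k) x y → R (g (y ∷ es) x) (h es x)) →
  ∀ d {n} (es : Vec (Fin m) n) → suc d < n → R (at g d es) (at h (suc d) (swap d es))
at-swap R r zero    (x ∷ y ∷ es) _ = r es x y
at-swap R r zero    (x ∷ []) (s≤s ())
at-swap R r (suc d) (x ∷ es) (s≤s d<n) = at-swap R r d es d<n

module _ {m : ℕ} (n : ℕ) where

  average : Score m → ℕ → ℕ
  average g d = ∑ᵤ n (at g d)

  average-≤ : ∀ {g h : Score m} d → (∀ {k} (es : Vec (Fin m) k) e → n ≡ d + suc k → g es e ≤ h es e) →
              average g d ≤ average h d
  average-≤ d g≤h = ∑ᵤ-mono n λ es → at-cong _≤_ d es z≤n g≤h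

  average-suc : ∀ {g : Score m} → (∀ {k} (es : Vec (Fin m) k) x y → g (y ∷ es) x ≤ g es x) →
                ∀ {d} → suc d < n → average g d ≤ average g (suc d)
  average-suc {g} mono {d} d<n = ≤-trans (∑ᵤ-mono n λ es → at-swap _≤_ {g} {g} mono d es d<n)
    (≤-reflexive (sym (∑ᵤ-swap n d (at g (suc d)))))

  average-mono : ∀ {g : Score m} → (∀ {k} (es : Vec (Fin m) k) x y → g (y ∷ es) x ≤ g es x) →
                 ∀ d i → d + i < n → average g d ≤ average g (d + i)
  average-mono {g} mono d zero    lt = ≤-reflexive (cong (average g) (sym (+-identityʳ d)))
  average-mono {g} mono d (suc i) lt rewrite +-suc d i =
    ≤-trans (average-mono {g} mono d i (<⇒≤ lt)) (average-suc {g} mono lt)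

  average-const : ∀ (f : Fin m → ℕ) d → d < n → average (λ _ → f) d ≡ average (λ _ → f) 0
  average-const f zero    d<n = refl
  average-const f (suc d) d<n = trans
    (trans (∑ᵤ-swap n d (at (λ _ → f) (suc d)))
      (∑ᵤ-cong n λ es → sym (at-swap _≡_ {λ _ → f} {λ _ → f} (λ _ _ _ → refl) d es d<n)))
    (average-const f d (<⇒≤ d<n))

  ∑ᵤ-tally : ∀ (g : Score m) → ∑ᵤ n (tally g) ≡ ∑< n (average g)
  ∑ᵤ-tally g = trans (∑ᵤ-cong n (tally-at g)) (∑ᵤ-∑< n n λ d → at g d)

count≤∣∣ : ∀ {m k} {es : Vec (Fin m) k} → Unique es → ∀ B → count B es ≤ ∣ B ∣
count≤∣∣ {es = es} uniq B = ≤-trans (≤-reflexive (sym (∣image∣ uniq _)))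
  (p⊆q⇒∣p∣≤∣q∣ λ x∈ → let i , i∈ , eq = ∈-image⁻ es (map (lookup B) es) x∈ in
    lookup⇒[]= _ B (trans (cong (lookup B) eq) (trans (sym (lookup-map i (lookup B) es)) ([]=⇒lookup i∈))))

tally≡count : ∀ {m} (B : Subset m) {k} (es : Vec (Fin m) k) → tally (λ _ e → ι (lookup B e)) es ≡ count B es
tally≡count B []       = refl
tally≡count B (e ∷ es) = trans (cong (ι (lookup B e) +_) (tally≡count B es)) (sym (∣∷∣ (lookup B e) (map (lookup B) es)))

ι-mono : ∀ {a b} → (T a → T b) → ι a ≤ ι b
ι-mono {false} f = z≤n
ι-mono {true} {true} f = ≤-refl
ι-mono {true} {false} f = contradiction (f _) λ ()

module _ {m} (M₁ M₂ : Matroid m) (O : Subset m) (a : ℕ) (b : ℕ) {n} (n≡ : n ≡ suc b + a) where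

  private
    length-early : ∀ i {k} → n ≡ suc b + i + suc k → k < a
    length-early i {k} eq = ≤-trans (m≤n+m (suc k) i) (≤-reflexive (+-cancelˡ-≡ (suc b) _ _
      (trans (sym (+-assoc (suc b) i (suc k))) (trans (sym eq) n≡))))

    length-late : ∀ {d k} → d < suc b → n ≡ d + suc k → ¬ k < a
    length-late {d} {k} d≤b eq k<a = <-irrefl (trans (sym eq) n≡) (+-mono-<-≤ d≤b k<a)

    greedyOptimal-antitone : ∀ c {k} (es : Vec (Fin m) k) x y →
      greedyOptimal M₁ M₂ O c (y ∷ es) x ≤ greedyOptimal M₁ M₂ O c es x
    greedyOptimal-antitone c es x y = ι-mono λ t →
      let t₀ , t′ = T-∧⁻ {lookup O x} t ; t₁ , t₂ = T-∧⁻ t′ in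
      T-∧⁺ t₀ (T-∧⁺ (hereditary M₁ (insert-mono x (Greedy-⊆ M₁ M₂ c y es)) t₁)
                    (hereditary M₂ (insert-mono x (Greedy-⊆ M₁ M₂ c y es)) t₂))

    split : ∀ f → ∑< n f ≡ ∑< (suc b) f + ∑< a (f ∘ (suc b +_))
    split f = trans (cong (λ p → ∑< p f) n≡) (∑<-+ (suc b) a f)

    average-zero : ∀ d → average {m} n (λ _ _ → 0) d ≡ 0
    average-zero d = trans (∑ᵤ-cong n λ es → at-zero d es) (∑ᵤ-* n 0 λ _ → 0)
      where
      at-zero : ∀ d {n} (es : Vec (Fin m) n) → at (λ _ _ → 0) d es ≡ 0
      at-zero d       []       = refl
      at-zero zero    (e ∷ es) = refl
      at-zero (suc d) (e ∷ es) = at-zero d es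

  -- Let `w` be the total at the first late arrival. Blocking only increases with time, so each of
  -- the `suc b` late arrivals contributes at most `w` on the left, while each of the first `suc a`
  -- arrivals contributes at least `w` to the tally on the right.
  lateUncovered≤greedyOptimal : suc b ≤ 8 * suc a →
    ∑ᵤ n (tally (lateUncovered M₁ M₂ O a)) ≤ 8 * ∑ᵤ n (tally (greedyOptimal M₁ M₂ O n))
  lateUncovered≤greedyOptimal b≤8a = begin
    ∑ᵤ n (tally late′)                              ≡⟨ trans (∑ᵤ-tally n late′) (split (average n late′)) ⟩
    ∑< (suc b) (average n late′) + ∑< a (average n late′ ∘ (suc b +_))
      ≤⟨ +-mono-≤ (∑<-≤ (suc b) before) (∑<-≤ a {c = 0} λ {i} _ → after i) ⟩
    suc b * w + a * 0                               ≡⟨ trans (cong (suc b * w +_) (*-zeroʳ a)) (+-identityʳ _) ⟩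
    suc b * w                                       ≤⟨ *-monoˡ-≤ w b≤8a ⟩
    8 * suc a * w                                   ≡⟨ *-assoc 8 (suc a) w ⟩
    8 * (suc a * w)                                 ≤⟨ *-monoʳ-≤ 8 (∑<-≥ (suc a) {f = average n greedy ∘ (b +_)} λ {i} i≤a →
                                                         average-mono n {greedy} (greedyOptimal-antitone n) b i (bound i≤a)) ⟩
    8 * ∑< (suc a) (average n greedy ∘ (b +_))      ≤⟨ *-monoʳ-≤ 8 (m≤n+m _ (∑< b (average n greedy))) ⟩
    8 * (∑< b (average n greedy) + ∑< (suc a) (average n greedy ∘ (b +_)))
      ≡⟨ cong (8 *_) (trans (sym (∑<-+ b (suc a) (average n greedy))) (cong (λ p → ∑< p (average n greedy)) (trans (+-suc b a) (sym n≡)))) ⟩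
    8 * ∑< n (average n greedy)                     ≡⟨ cong (8 *_) (∑ᵤ-tally n greedy) ⟨
    8 * ∑ᵤ n (tally greedy)                         ∎
    where
    open ≤-Reasoning
    late′ greedy : Score m
    late′ = lateUncovered M₁ M₂ O a
    greedy = greedyOptimal M₁ M₂ O n
    -- Exactly `a` elements precede the arrival at depth `b`, so there greedy cut off at `a` and
    -- full greedy have the same set.
    w = average n greedy b
    bound : ∀ {i} → i < suc a → b + i < n
    bound i≤a = ≤-trans (+-monoʳ-< b i≤a) (≤-reflexive (trans (+-suc b a) (sym n≡)))
    late≤ : ∀ {k} (es : Vec (Fin m) k) e → late′ es e ≤ greedyOptimal M₁ M₂ O a es e
    late≤ {k} es e with k <ᵇ a
    ... | true = z≤n
    ... | false = ≤-refl
    before : ∀ {d} → d < suc b → average n late′ d ≤ w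
    before {d} (s≤s d≤b) = begin
      average n late′ d                          ≤⟨ average-≤ n {late′} d (λ es e _ → late≤ es e) ⟩
      average n (greedyOptimal M₁ M₂ O a) d      ≤⟨ average-mono n {greedyOptimal M₁ M₂ O a} (greedyOptimal-antitone a) d (b ∸ d)
                                                     (≤-trans (s≤s (≤-reflexive (m+[n∸m]≡n d≤b))) (≤-trans (m≤m+n (suc b) a) (≤-reflexive (sym n≡)))) ⟩
      average n (greedyOptimal M₁ M₂ O a) (d + (b ∸ d)) ≡⟨ cong (average n (greedyOptimal M₁ M₂ O a)) (m+[n∸m]≡n d≤b) ⟩
      average n (greedyOptimal M₁ M₂ O a) b      ≤⟨ average-≤ n {greedyOptimal M₁ M₂ O a} b (λ es e eq → cutoff es e eq) ⟩
      w                                          ∎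
      where
      cutoff : ∀ {k} (es : Vec (Fin m) k) e → n ≡ b + suc k → greedyOptimal M₁ M₂ O a es e ≤ greedy es e
      cutoff {k} es e eq = ≤-reflexive (cong (λ u → ι (lookup O e ∧ (oracle M₁ (⁅ e ⁆ ∪ image es u) ∧ oracle M₂ (⁅ e ⁆ ∪ image es u))))
        (accepted-cutoff M₁ M₂ es k≤a (≤-trans k≤a (≤-trans (m≤n+m a (suc b)) (≤-reflexive (sym n≡))))))
        where
        k≤a : k ≤ a
        k≤a = ≤-reflexive (suc-injective (+-cancelˡ-≡ b _ _ (trans (sym eq) (trans n≡ (sym (+-suc b a))))))
    after : ∀ i → average n late′ (suc b + i) ≤ 0
    after i = ≤-trans (average-≤ n {late′} {λ _ _ → 0} (suc b + i) λ {k} es e eq → zero-early (length-early i eq) es e)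
      (≤-reflexive (average-zero (suc b + i)))
      where
      zero-early : ∀ {k} → k < a → ∀ (es : Vec (Fin m) k) e → late′ es e ≤ 0
      zero-early k<a es e rewrite <⇒<ᵇ≡ k<a = ≤-refl

  -- Optimal elements are equally likely at every arrival time, so their early share is `a / n`.
  earlyOptimal≤ : 8 * a ≤ n →
    8 * ∑ᵤ n (tally (earlyOptimal M₁ M₂ O a)) ≤ ∑ᵤ n (tally (λ _ e → ι (lookup O e)))
  earlyOptimal≤ 8a≤n = begin
    8 * ∑ᵤ n (tally early)                            ≡⟨ cong (8 *_) (trans (∑ᵤ-tally n early) (split (average n early))) ⟩
    8 * (∑< (suc b) (average n early) + ∑< a (average n early ∘ (suc b +_)))
      ≤⟨ *-monoʳ-≤ 8 (+-mono-≤ (∑<-≤ (suc b) {c = 0} before) (∑<-≤ a after)) ⟩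
    8 * (suc b * 0 + a * l)                           ≡⟨ lemma b a l ⟩
    8 * a * l                                         ≤⟨ *-monoˡ-≤ l 8a≤n ⟩
    n * l                                             ≤⟨ ∑<-≥ n (λ {d} d<n → ≤-reflexive (sym (average-const n weight d d<n))) ⟩
    ∑< n (average n λ _ → weight)                     ≡⟨ ∑ᵤ-tally n (λ _ → weight) ⟨
    ∑ᵤ n (tally λ _ → weight)                         ∎
    where
    open ≤-Reasoning
    early : Score m
    early = earlyOptimal M₁ M₂ O a
    weight : Fin m → ℕ
    weight e = ι (lookup O e)
    l = average n (λ _ → weight) 0
    lemma : ∀ b a l → 8 * (suc b * 0 + a * l) ≡ 8 * a * l
    lemma = solve-∀
    before : ∀ {d} → d < suc b → average n early d ≤ 0
    before {d} d≤b = ≤-trans (average-≤ n {early} {λ _ _ → 0} d λ es e eq → zero-late (length-late d≤b eq) es e)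
      (≤-reflexive (average-zero d))
      where
      zero-late : ∀ {k} → ¬ k < a → ∀ (es : Vec (Fin m) k) e → early es e ≤ 0
      zero-late k≮a es e rewrite ≮⇒<ᵇ≡ k≮a = ≤-refl
    after : ∀ {i} → i < a → average n early (suc b + i) ≤ l
    after {i} i<a = ≤-trans (average-≤ n {early} {λ _ → weight} (suc b + i) λ es e _ → early≤ es e)
      (≤-reflexive (average-const n weight (suc b + i) (≤-trans (+-monoʳ-< (suc b) i<a) (≤-reflexive (sym n≡)))))
      where
      early≤ : ∀ {k} (es : Vec (Fin m) k) e → early es e ≤ weight e
      early≤ {k} es e with k <ᵇ a
      ... | true = ≤-refl
      ... | false = z≤n

-- Averaging over all orders and combining the bounds

vsum-map-mono : ∀ {a} {A : Set a} {n} {f g : A → ℕ} → (∀ x → f x ≤ g x) → (xs : Vec A n) →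
                vsum (map f xs) ≤ vsum (map g xs)
vsum-map-mono f≤g []       = z≤n
vsum-map-mono f≤g (x ∷ xs) = +-mono-≤ (f≤g x) (vsum-map-mono f≤g xs)

vsum-map-+ : ∀ {a} {A : Set a} {n} (f g : A → ℕ) (xs : Vec A n) →
             vsum (map (λ x → f x + g x) xs) ≡ vsum (map f xs) + vsum (map g xs)
vsum-map-+ f g []       = refl
vsum-map-+ f g (x ∷ xs) = trans (cong ((f x + g x) +_) (vsum-map-+ f g xs)) (+-interchange (f x) (g x) _ _)

vsum-map-* : ∀ {a} {A : Set a} {n} c (f : A → ℕ) (xs : Vec A n) → vsum (map (λ x → c * f x) xs) ≡ c * vsum (map f xs)
vsum-map-* c f []       = sym (*-zeroʳ c)
vsum-map-* c f (x ∷ xs) = trans (cong (c * f x +_) (vsum-map-* c f xs)) (sym (*-distribˡ-+ c (f x) _))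

vsum-map-const : ∀ {a} {A : Set a} {n} c (xs : Vec A n) → vsum (map (λ _ → c) xs) ≡ n * c
vsum-map-const c []       = refl
vsum-map-const c (x ∷ xs) = cong (c +_) (vsum-map-const c xs)

history-unique : ∀ {m} (π : Permutation′ m) → Unique (history π)
history-unique π = tabulate⁺ λ {i} {j} eq →
  trans (sym (Perm.inverseˡ π)) (trans (cong (π ⟨$⟩ˡ_) eq) (Perm.inverseˡ π))

history-surjective : ∀ {m} (π : Permutation′ m) x → ∃[ i ] lookup (history π) i ≡ x
history-surjective π x = π ⟨$⟩ˡ x , trans (lookup∘tabulate (π ⟨$⟩ʳ_) _) (Perm.inverseʳ π)

module _ {m} (M₁ M₂ : Matroid m) where

  greedy-size augmented-size : Permutation′ m → ℕ
  greedy-size π = ∣ accepted m (observed M₁ (history π)) (observed M₂ (history π)) ∣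
  augmented-size π = ∑ₛ m λ v → ∣ marked-greedy (m / 8) (bit v) (observed M₁ (history π)) (observed M₂ (history π)) ∣

  total-size : ℕ
  total-size = vsum (map (λ π → augmented-size π + 15 * (2 ^ m * greedy-size π)) (permutations m))

module _ {m} (M₁ M₂ : Matroid m) {O : Subset m} (O∈I : CommonIndependent M₁ M₂ O) where

  private
    a W V K : ℕ
    a = m / 8
    W = 2 ^ m
    V = m !
    K = V * ∣ O ∣

    ∑ₚ : (Permutation′ m → ℕ) → ℕ
    ∑ₚ f = vsum (map f (permutations m))

    greedy augmented : Permutation′ m → ℕ
    greedy    = greedy-size M₁ M₂
    augmented = augmented-size M₁ M₂

    late-score early-score greedy-score : Permutation′ m → ℕ
    late-score   = tally (lateUncovered M₁ M₂ O a) ∘ history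
    early-score  = tally (earlyOptimal M₁ M₂ O a) ∘ history
    greedy-score = tally (greedyOptimal M₁ M₂ O m) ∘ history

  private
    8a≤m : 8 * a ≤ m
    8a≤m = ≤-trans (≤-reflexive (*-comm 8 a)) (m/n*n≤m m 8)

    m≤8[1+a] : m ≤ 8 * suc a
    m≤8[1+a] = begin
      m                        ≡⟨ m≡m%n+[m/n]*n m 8 ⟩
      m % 8 + a * 8 ≤⟨ +-monoˡ-≤ (a * 8) (<⇒≤ (m%n<n m 8)) ⟩
      8 + a * 8                ≡⟨ cong (8 +_) (*-comm a 8) ⟩
      8 + 8 * a                ≡⟨ *-suc 8 a ⟨
      8 * suc a                ∎
      where open ≤-Reasoning

    -- On a nonempty ground set at least one arrival is late, which the decomposition `suc b + a`
    -- requires; this is why `m = 0` is treated apart below.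
    m≡ : m ≢ 0 → m ≡ suc (m ∸ suc a) + a
    m≡ m≢0 = trans (sym (m∸n+n≡m (m/n<m m 8 (s≤s (s≤s z≤n))))) (+-suc (m ∸ suc a) a)
      where instance _ = ≢-nonZero m≢0

    early-total : 8 * ∑ₚ early-score ≤ K
    early-total with ℕₚ._≟_ m 0
    ... | yes refl = z≤n
    ... | no m≢0 = begin
      8 * ∑ₚ early-score                                ≡⟨ cong (8 *_) (∑ₕ≡∑ᵤ {m} (tally (earlyOptimal M₁ M₂ O a))) ⟩
      8 * ∑ᵤ m (tally (earlyOptimal M₁ M₂ O a))          ≤⟨ earlyOptimal≤ M₁ M₂ O a (m ∸ suc a) n≡ 8a≤m ⟩
      ∑ᵤ m (tally λ _ e → ι (lookup O e))                ≡⟨ ∑ₕ≡∑ᵤ {m} (tally λ _ e → ι (lookup O e)) ⟨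
      ∑ₚ (tally (λ _ e → ι (lookup O e)) ∘ history)      ≤⟨ vsum-map-mono (λ π → ≤-trans (≤-reflexive (tally≡count O (history π)))
                                                            (count≤∣∣ (history-unique π) O)) (permutations m) ⟩
      ∑ₚ (λ _ → ∣ O ∣)                                  ≡⟨ vsum-map-const ∣ O ∣ (permutations m) ⟩
      K                                                 ∎
      where
      open ≤-Reasoning
      n≡ = m≡ m≢0

    late-total : ∑ₚ late-score ≤ 8 * ∑ₚ greedy-score
    late-total with ℕₚ._≟_ m 0
    ... | yes refl = z≤n
    ... | no m≢0 = begin
      ∑ₚ late-score                                      ≡⟨ ∑ₕ≡∑ᵤ {m} (tally (lateUncovered M₁ M₂ O a)) ⟩
      ∑ᵤ m (tally (lateUncovered M₁ M₂ O a))             ≤⟨ lateUncovered≤greedyOptimal M₁ M₂ O a (m ∸ suc a) n≡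
                                                              (≤-trans (m≤m+n _ a) (≤-trans (≤-reflexive (sym n≡)) m≤8[1+a])) ⟩
      8 * ∑ᵤ m (tally (greedyOptimal M₁ M₂ O m))         ≡⟨ cong (8 *_) (∑ₕ≡∑ᵤ {m} (tally (greedyOptimal M₁ M₂ O m))) ⟨
      8 * ∑ₚ greedy-score                                ∎
      where
      open ≤-Reasoning
      n≡ = m≡ m≢0

    greedy-total : K + ∑ₚ greedy-score ≤ 2 * ∑ₚ greedy
    greedy-total = begin
      K + ∑ₚ greedy-score                        ≡⟨ cong (_+ ∑ₚ greedy-score) (vsum-map-const ∣ O ∣ (permutations m)) ⟨
      ∑ₚ (λ _ → ∣ O ∣) + ∑ₚ greedy-score         ≡⟨ vsum-map-+ (λ _ → ∣ O ∣) greedy-score (permutations m) ⟨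
      ∑ₚ (λ π → ∣ O ∣ + greedy-score π)          ≤⟨ vsum-map-mono (λ π → greedy-bound M₁ M₂ O O∈I (history-unique π) ≤-refl
                                                      (history-surjective π)) (permutations m) ⟩
      ∑ₚ (λ π → 2 * greedy π)               ≡⟨ vsum-map-* 2 greedy (permutations m) ⟩
      2 * ∑ₚ greedy                         ∎
      where open ≤-Reasoning

    augmented-total : 4 * (W * K) ≤ 6 * ∑ₚ augmented + W * ∑ₚ greedy + 4 * (W * ∑ₚ late-score) + 2 * (W * ∑ₚ early-score)
    augmented-total = begin
      4 * (W * (V * ∣ O ∣))                          ≡⟨ regroup W V ∣ O ∣ ⟩
      V * (4 * (W * ∣ O ∣))                          ≡⟨ vsum-map-const (4 * (W * ∣ O ∣)) (permutations m) ⟨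
      ∑ₚ (λ _ → 4 * (W * ∣ O ∣))                     ≤⟨ vsum-map-mono pointwise (permutations m) ⟩
      ∑ₚ (λ π → 6 * augmented π + W * greedy π + 4 * (W * late-score π) + 2 * (W * early-score π))
        ≡⟨ trans (∑ₚ-+ (λ π → 6 * augmented π + W * greedy π + 4 * (W * late-score π)) (λ π → 2 * (W * early-score π)))
             (cong₂ _+_ (trans (∑ₚ-+ (λ π → 6 * augmented π + W * greedy π) (λ π → 4 * (W * late-score π)))
               (cong₂ _+_ (trans (∑ₚ-+ (λ π → 6 * augmented π) (λ π → W * greedy π))
                 (cong₂ _+_ (∑ₚ-* 6 augmented) (∑ₚ-* W greedy)))
                 (trans (∑ₚ-* 4 (λ π → W * late-score π)) (cong (4 *_) (∑ₚ-* W late-score)))))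
               (trans (∑ₚ-* 2 (λ π → W * early-score π)) (cong (2 *_) (∑ₚ-* W early-score)))) ⟩
      6 * ∑ₚ augmented + W * ∑ₚ greedy + 4 * (W * ∑ₚ late-score) + 2 * (W * ∑ₚ early-score) ∎
      where
      open ≤-Reasoning
      ∑ₚ-+ : ∀ f g → ∑ₚ (λ π → f π + g π) ≡ ∑ₚ f + ∑ₚ g
      ∑ₚ-+ f g = vsum-map-+ f g (permutations m)
      ∑ₚ-* : ∀ c f → ∑ₚ (λ π → c * f π) ≡ c * ∑ₚ f
      ∑ₚ-* c f = vsum-map-* c f (permutations m)
      regroup : ∀ w v o → 4 * (w * (v * o)) ≡ v * (4 * (w * o))
      regroup = solve-∀
      pointwise : ∀ π → 4 * (W * ∣ O ∣) ≤ 6 * augmented π + W * greedy π + 4 * (W * late-score π) + 2 * (W * early-score π)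
      pointwise π = ≤-trans (marked-greedy-bound M₁ M₂ a O∈I (history-unique π) (history-surjective π))
        (+-monoˡ-≤ (2 * (W * early-score π)) (+-monoˡ-≤ (4 * (W * late-score π)) (+-monoʳ-≤ (6 * augmented π)
          (*-monoʳ-≤ W (∣accepted∣-mono M₁ M₂ a (history π) ≤-refl)))))

  -- Up to normalisation `24 P ≥ 143 K - 260 G`, so `24 (P + 15 G) ≥ 143 K + 100 G ≥ 193 K` by
  -- `K ≤ 2 G`. The weight of greedy must exceed `260 / 24` for a positive coefficient of `G`, and
  -- 15 : 1 is what four fair coins can realise. Division by `24 * 16 = 384` gives the ratio
  -- 193/384.
  mixture-bound : 193 * (∣ O ∣ * (2 ^ (4 + m) * m !)) ≤
    384 * total-size M₁ M₂
  mixture-bound = begin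
    193 * (∣ O ∣ * (2 ^ (4 + m) * m !))              ≡⟨ lhs ∣ O ∣ W V ⟩
    16 * (143 * (W * K)) + 800 * (W * K)             ≤⟨ +-mono-≤ (*-monoʳ-≤ 16 combined) (*-monoʳ-≤ 800 (*-monoʳ-≤ W K≤2G)) ⟩
    16 * (24 * P + 260 * (W * G)) + 800 * (W * (2 * G)) ≡⟨ rhs P W G ⟩
    384 * (P + 15 * (W * G))                         ≡⟨ cong (384 *_) total ⟨
    384 * ∑ₚ (λ π → augmented π + 15 * (W * greedy π)) ∎
    where
    open ≤-Reasoning
    P = ∑ₚ augmented
    G = ∑ₚ greedy
    Q = ∑ₚ greedy-score
    C = ∑ₚ late-score
    D = ∑ₚ early-score
    lhs : ∀ o w v → 193 * (o * (2 * (2 * (2 * (2 * w))) * v)) ≡ 16 * (143 * (w * (v * o))) + 800 * (w * (v * o))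
    lhs = solve-∀
    rhs : ∀ p w g → 16 * (24 * p + 260 * (w * g)) + 800 * (w * (2 * g)) ≡ 384 * (p + 15 * (w * g))
    rhs = solve-∀
    K≤2G : K ≤ 2 * G
    K≤2G = ≤-trans (m≤m+n K Q) greedy-total
    total : ∑ₚ (λ π → augmented π + 15 * (W * greedy π)) ≡ P + 15 * (W * G)
    total = trans (vsum-map-+ augmented (λ π → 15 * (W * greedy π)) (permutations m))
      (cong (P +_) (trans (vsum-map-* 15 (λ π → W * greedy π) (permutations m))
        (cong (15 *_) (vsum-map-* W greedy (permutations m)))))
    -- Eliminates `Q`: four copies of the augmentation bound contain `16 C`, at most `128 Q`, and
    -- 128 copies of `greedy-total` pay for this. The early elements `8 D` cost one `K`, so the
    -- coefficient of `K` is `16 + 128 - 1`.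
    combined : 143 * (W * K) ≤ 24 * P + 260 * (W * G)
    combined = +-cancelʳ-≤ (W * K + 128 * (W * Q)) _ _ (begin
      143 * (W * K) + (W * K + 128 * (W * Q))
        ≡⟨ step₁ W K Q ⟩
      4 * (4 * (W * K)) + 128 * (W * (K + Q))
        ≤⟨ +-mono-≤ (*-monoʳ-≤ 4 augmented-total) (*-monoʳ-≤ 128 (*-monoʳ-≤ W greedy-total)) ⟩
      4 * (6 * P + W * G + 4 * (W * C) + 2 * (W * D)) + 128 * (W * (2 * G))
        ≡⟨ step₂ P W G C D ⟩
      24 * P + 260 * (W * G) + (W * (8 * D) + 16 * (W * C))
        ≤⟨ +-monoʳ-≤ (24 * P + 260 * (W * G)) (+-mono-≤ (*-monoʳ-≤ W early-total) (*-monoʳ-≤ 16 (*-monoʳ-≤ W late-total))) ⟩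
      24 * P + 260 * (W * G) + (W * K + 16 * (W * (8 * Q)))
        ≡⟨ step₃ W Q (24 * P + 260 * (W * G)) K ⟩
      24 * P + 260 * (W * G) + (W * K + 128 * (W * Q)) ∎)
      where
      step₁ : ∀ w k q → 143 * (w * k) + (w * k + 128 * (w * q)) ≡ 4 * (4 * (w * k)) + 128 * (w * (k + q))
      step₁ = solve-∀
      step₂ : ∀ p w g c d → 4 * (6 * p + w * g + 4 * (w * c) + 2 * (w * d)) + 128 * (w * (2 * g)) ≡
                            24 * p + 260 * (w * g) + (w * (8 * d) + 16 * (w * c))
      step₂ = solve-∀
      step₃ : ∀ w q x k → x + (w * k + 16 * (w * (8 * q))) ≡ x + (w * k + 128 * (w * q))
      step₃ = solve-∀

-- Mixing with greedy, and expectations as rational numbers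

subsets : ∀ n → Vec (Subset n) (2 ^ n)
subsets zero    = [] ∷ []
-- The trailing `[]` fits the length, since `2 ^ suc n` computes to `2 ^ n + (2 ^ n + 0)`.
subsets (suc n) = map (true ∷_) (subsets n) ++ (map (false ∷_) (subsets n) ++ [])

vsum-subsets : ∀ n (f : Subset n → ℕ) → vsum (map f (subsets n)) ≡ ∑ₛ n f
vsum-subsets zero    f = +-identityʳ (f [])
vsum-subsets (suc n) f = begin
  vsum (map f (xs ++ (ys ++ [])))                   ≡⟨ cong vsum (map-++ f xs (ys ++ [])) ⟩
  vsum (map f xs ++ map f (ys ++ []))               ≡⟨ sum-++ (map f xs) ⟩
  vsum (map f xs) + vsum (map f (ys ++ []))         ≡⟨ cong (λ zs → vsum (map f xs) + vsum zs) (map-++ f ys []) ⟩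
  vsum (map f xs) + vsum (map f ys ++ [])           ≡⟨ cong (vsum (map f xs) +_) (trans (sum-++ (map f ys)) (+-identityʳ _)) ⟩
  vsum (map f xs) + vsum (map f ys)                 ≡⟨ cong₂ _+_ (half true) (half false) ⟩
  ∑ₛ n (f ∘ (true ∷_)) + ∑ₛ n (f ∘ (false ∷_))      ∎
  where
  open ≡-Reasoning
  xs = map (true ∷_) (subsets n)
  ys = map (false ∷_) (subsets n)
  half : ∀ b → vsum (map f (map (b ∷_) (subsets n))) ≡ ∑ₛ n (f ∘ (b ∷_))
  half b = trans (cong vsum (sym (map-∘ f (b ∷_) (subsets n)))) (vsum-subsets n (f ∘ (b ∷_)))

-- Four coin tosses select the marked greedy algorithm with probability 1/16 and
-- the plain greedy algorithm otherwise; the other tosses are the marks.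
mixture : ∀ m → Subset (4 + m) → ∀ {k} → Oracle k → Oracle k → Subset k
mixture m (b₁ ∷ b₂ ∷ b₃ ∷ b₄ ∷ v) o₁ o₂ =
  if b₁ ∧ (b₂ ∧ (b₃ ∧ b₄)) then marked-greedy (m / 8) (bit v) o₁ o₂ else accepted m o₁ o₂

-- The strategy recomputes the whole run at each arrival and outputs its newest entry. Since a later
-- arrival never revises earlier entries, the recomputed run agrees with the actual picks.
mixture-∷ : ∀ m s {k} (o₁ o₂ : Oracle (suc k)) →
  mixture m s o₁ o₂ ≡ head (mixture m s o₁ o₂) ∷ mixture m s (restrict o₁) (restrict o₂)
mixture-∷ m (b₁ ∷ b₂ ∷ b₃ ∷ b₄ ∷ v) o₁ o₂ with b₁ ∧ (b₂ ∧ (b₃ ∧ b₄))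
... | true  = refl
... | false = refl

mixture-common : ∀ {m} s (M₁ M₂ : Matroid m) {k} (es : Vec (Fin m) k) →
  CommonIndependent M₁ M₂ (image es (mixture m s (observed M₁ es) (observed M₂ es)))
mixture-common {m} (b₁ ∷ b₂ ∷ b₃ ∷ b₄ ∷ v) M₁ M₂ es with b₁ ∧ (b₂ ∧ (b₃ ∧ b₄))
... | true  = marked-greedy-common M₁ M₂ (m / 8) (bit v) es
... | false = Greedy-independent M₁ M₂ m es

mixture-strategy : RandomizedStrategy
mixture-strategy = record
  { seeds   = λ m → 2 ^ (4 + m)
  ; decide  = λ m r o₁ o₂ _ → head (mixture m (lookup (subsets (4 + m)) r) o₁ o₂)
  ; seeds≢0 = λ {m} → m^n≢0 2 (4 + m)
  }

picked-mixture : ∀ {m k} (M₁ M₂ : Matroid m) r (es : Vec (Fin m) k) →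
  RandomizedStrategy.picked mixture-strategy M₁ M₂ r es ≡
  mixture m (lookup (subsets (4 + m)) r) (observed M₁ es) (observed M₂ es)
picked-mixture {m} M₁ M₂ r [] with mixture m (lookup (subsets (4 + m)) r) (observed M₁ []) (observed M₂ [])
... | [] = refl
picked-mixture {m} M₁ M₂ r (e ∷ es) = trans
  (cong (head (mixture m s (observed M₁ (e ∷ es)) (observed M₂ (e ∷ es))) ∷_) (picked-mixture M₁ M₂ r es))
  (sym (mixture-∷ m s (observed M₁ (e ∷ es)) (observed M₂ (e ∷ es))))
  where s = lookup (subsets (4 + m)) r

mixture-algorithm : OnlineAlgorithm
mixture-algorithm = record
  { strategy = mixture-strategy
  ; feasible = λ {m} M₁ M₂ r es _ → subst (CommonIndependent M₁ M₂ ∘ image es)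
      (sym (picked-mixture M₁ M₂ r es)) (mixture-common (lookup (subsets (4 + m)) r) M₁ M₂ es)
  }

∑ₛ-mixture : ∀ {m} (M₁ M₂ : Matroid m) {k} (es : Vec (Fin m) k) →
  ∑ₛ (4 + m) (λ s → ∣ mixture m s (observed M₁ es) (observed M₂ es) ∣) ≡
  ∑ₛ m (λ v → ∣ marked-greedy (m / 8) (bit v) (observed M₁ es) (observed M₂ es) ∣) +
  15 * (2 ^ m * ∣ accepted m (observed M₁ es) (observed M₂ es) ∣)
∑ₛ-mixture {m} M₁ M₂ es = trans
  (lemma p (∑ₛ m λ _ → g))
  (cong (λ x → p + 15 * x) (∑ₛ-const m g))
  where
  p = ∑ₛ m λ v → ∣ marked-greedy (m / 8) (bit v) (observed M₁ es) (observed M₂ es) ∣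
  g = ∣ accepted m (observed M₁ es) (observed M₂ es) ∣
  lemma : ∀ p x → (((p + x) + (x + x)) + ((x + x) + (x + x))) + (((x + x) + (x + x)) + ((x + x) + (x + x))) ≡ p + 15 * x
  lemma = solve-∀

fromℕ : ℕ → ℚ
fromℕ n = ℤ.+ n ℚ./ 1

fromℕ-+ : ∀ a b → fromℕ a ℚ.+ fromℕ b ≡ fromℕ (a + b)
fromℕ-+ a b = ℚₚ.toℚᵘ-injective (begin
  ℚ.toℚᵘ (fromℕ a ℚ.+ fromℕ b)             ≈⟨ ℚₚ.toℚᵘ-homo-+ (fromℕ a) (fromℕ b) ⟩
  ℚ.toℚᵘ (fromℕ a) ℚᵘ.+ ℚ.toℚᵘ (fromℕ b)   ≈⟨ ℚᵘₚ.+-cong (ℚₚ.toℚᵘ-fromℚᵘ (mkℚᵘ (ℤ.+ a) 0)) (ℚₚ.toℚᵘ-fromℚᵘ (mkℚᵘ (ℤ.+ b) 0)) ⟩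
  mkℚᵘ (ℤ.+ a) 0 ℚᵘ.+ mkℚᵘ (ℤ.+ b) 0       ≈⟨ *≡* (cong (ℤ._* ℤ.+ 1) (cong₂ ℤ._+_ (ℤₚ.*-identityʳ (ℤ.+ a)) (ℤₚ.*-identityʳ (ℤ.+ b)))) ⟩
  mkℚᵘ (ℤ.+ (a + b)) 0                     ≈⟨ ℚₚ.toℚᵘ-fromℚᵘ (mkℚᵘ (ℤ.+ (a + b)) 0) ⟨
  ℚ.toℚᵘ (fromℕ (a + b))                   ∎)
  where open ℚᵘₚ.≃-Reasoning

-- The factor `c` lets one lemma serve both nested means: it is one for the mean over seeds, and the
-- normalisation of that mean for the one over orders.
mean-fromℕ : ∀ {a} {A : Set a} {n} ⦃ _ : NonZero n ⦄ (f : A → ℕ) c (xs : Vec A n) →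
  mean (map (λ x → fromℕ (f x) ℚ.* c) xs) ≡ fromℕ (vsum (map f xs)) ℚ.* c ℚ.* (ℤ.+ 1 ℚ./ n)
mean-fromℕ {A = A} {n} f c xs = cong (ℚ._* (ℤ.+ 1 ℚ./ n)) (total xs)
  where
  total : ∀ {n} (xs : Vec A n) → foldr′ ℚ._+_ 0ℚ (map (λ x → fromℕ (f x) ℚ.* c) xs) ≡ fromℕ (vsum (map f xs)) ℚ.* c
  total []       = sym (ℚₚ.*-zeroˡ c)
  total (x ∷ xs) = trans (cong (fromℕ (f x) ℚ.* c ℚ.+_) (total xs))
    (trans (sym (ℚₚ.*-distribʳ-+ c (fromℕ (f x)) _)) (cong (ℚ._* c) (fromℕ-+ (f x) _)))

fraction-≤ : ∀ k S R V ⦃ _ : NonZero R ⦄ ⦃ _ : NonZero V ⦄ → 193 * (k * (R * V)) ≤ 384 * S →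
  (½ ℚ.+ ℤ.+ 1 ℚ./ 384) ℚ.* fromℕ k ℚ.≤ fromℕ S ℚ.* (ℤ.+ 1 ℚ./ R) ℚ.* (ℤ.+ 1 ℚ./ V)
fraction-≤ k S (suc R) (suc V) le = ℚₚ.toℚᵘ-cancel-≤ (begin
  ℚ.toℚᵘ ((½ ℚ.+ ℤ.+ 1 ℚ./ 384) ℚ.* fromℕ k)
    ≃⟨ ℚₚ.toℚᵘ-homo-* (½ ℚ.+ ℤ.+ 1 ℚ./ 384) (fromℕ k) ⟩
  -- One half plus 1/384 is 193/384; `mkℚᵘ` takes the denominator minus one.
  mkℚᵘ (ℤ.+ 193) 383 ℚᵘ.* ℚ.toℚᵘ (fromℕ k)
    ≃⟨ ℚᵘₚ.*-congˡ {mkℚᵘ (ℤ.+ 193) 383} (ℚₚ.toℚᵘ-fromℚᵘ (mkℚᵘ (ℤ.+ k) 0)) ⟩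
  mkℚᵘ (ℤ.+ 193) 383 ℚᵘ.* mkℚᵘ (ℤ.+ k) 0
    ≤⟨ *≤* cross ⟩
  mkℚᵘ (ℤ.+ S) 0 ℚᵘ.* mkℚᵘ (ℤ.+ 1) R ℚᵘ.* mkℚᵘ (ℤ.+ 1) V
    ≃⟨ ℚᵘₚ.*-cong (ℚᵘₚ.*-cong (ℚₚ.toℚᵘ-fromℚᵘ (mkℚᵘ (ℤ.+ S) 0)) (ℚₚ.toℚᵘ-fromℚᵘ (mkℚᵘ (ℤ.+ 1) R))) (ℚₚ.toℚᵘ-fromℚᵘ (mkℚᵘ (ℤ.+ 1) V)) ⟨
  ℚ.toℚᵘ (fromℕ S) ℚᵘ.* ℚ.toℚᵘ (ℤ.+ 1 ℚ./ suc R) ℚᵘ.* ℚ.toℚᵘ (ℤ.+ 1 ℚ./ suc V)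
    ≃⟨ ℚᵘₚ.*-congʳ (ℚₚ.toℚᵘ-homo-* (fromℕ S) (ℤ.+ 1 ℚ./ suc R)) ⟨
  ℚ.toℚᵘ (fromℕ S ℚ.* (ℤ.+ 1 ℚ./ suc R)) ℚᵘ.* ℚ.toℚᵘ (ℤ.+ 1 ℚ./ suc V)
    ≃⟨ ℚₚ.toℚᵘ-homo-* (fromℕ S ℚ.* (ℤ.+ 1 ℚ./ suc R)) (ℤ.+ 1 ℚ./ suc V) ⟨
  ℚ.toℚᵘ (fromℕ S ℚ.* (ℤ.+ 1 ℚ./ suc R) ℚ.* (ℤ.+ 1 ℚ./ suc V)) ∎)
  where
  open ℚᵘₚ.≤-Reasoning
  cross : (ℤ.+ 193 ℤ.* ℤ.+ k) ℤ.* ℤ.+ (1 * suc R * suc V) ℤ.≤ (ℤ.+ S ℤ.* ℤ.+ 1 ℤ.* ℤ.+ 1) ℤ.* ℤ.+ 384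
  cross = subst₂ ℤ._≤_
    (trans (cong ℤ.+_ (left k (suc R) (suc V))) (trans (ℤₚ.pos-* (193 * k) (1 * suc R * suc V)) (cong (ℤ._* ℤ.+ (1 * suc R * suc V)) (ℤₚ.pos-* 193 k))))
    (trans (cong ℤ.+_ (*-comm 384 S)) (trans (ℤₚ.pos-* S 384) (cong (ℤ._* ℤ.+ 384)
      (sym (trans (ℤₚ.*-identityʳ _) (ℤₚ.*-identityʳ (ℤ.+ S)))))))
    (ℤ.+≤+ le)
    where
    left : ∀ k r v → 193 * (k * (r * v)) ≡ 193 * k * (1 * r * v)
    left = solve-∀

expectedSize-mixture : ∀ {m} (M₁ M₂ : Matroid m) → expectedSize mixture-algorithm M₁ M₂ ≡
  fromℕ (total-size M₁ M₂)
    ℚ.* (ℚ._/_ (ℤ.+ 1) (2 ^ (4 + m)) ⦃ m^n≢0 2 (4 + m) ⦄) ℚ.* (ℚ._/_ (ℤ.+ 1) (m !) ⦃ m !≢0 ⦄)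
expectedSize-mixture {m} M₁ M₂ = trans
  (cong (λ xs → mean ⦃ m !≢0 ⦄ xs) (map-cong mean-size (permutations m)))
  (mean-fromℕ ⦃ m !≢0 ⦄ (λ π → augmented-size M₁ M₂ π + 15 * (2 ^ m * greedy-size M₁ M₂ π)) 1/R (permutations m))
  where
  open OnlineAlgorithm mixture-algorithm
  R = 2 ^ (4 + m)
  instance
    R≢0 : NonZero R
    R≢0 = m^n≢0 2 (4 + m)
  1/R = ℤ.+ 1 ℚ./ R
  module _ (π : Permutation′ m) where
    size : Subset (4 + m) → ℕ
    size s = ∣ mixture m s (observed M₁ (history π)) (observed M₂ (history π)) ∣
    size-picked : ∀ r → fromℕ ∣ picked M₁ M₂ r (history π) ∣ ≡ fromℕ (size (lookup (subsets (4 + m)) r)) ℚ.* ℚ.1ℚ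
    size-picked r = trans (cong (fromℕ ∘ ∣_∣) (picked-mixture M₁ M₂ r (history π))) (sym (ℚₚ.*-identityʳ _))
    total : vsum (map (size ∘ lookup (subsets (4 + m))) (allFin R)) ≡ augmented-size M₁ M₂ π + 15 * (2 ^ m * greedy-size M₁ M₂ π)
    total = trans (cong vsum (trans (map-∘ size (lookup (subsets (4 + m))) (allFin R)) (cong (map size) (map-lookup-allFin (subsets (4 + m))))))
      (trans (vsum-subsets (4 + m) size) (∑ₛ-mixture M₁ M₂ (history π)))
    mean-size : mean (map (λ r → fromℕ ∣ picked M₁ M₂ r (history π) ∣) (allFin R)) ≡
              fromℕ (augmented-size M₁ M₂ π + 15 * (2 ^ m * greedy-size M₁ M₂ π)) ℚ.* 1/R
    mean-size = trans (cong (λ xs → mean xs) (map-cong size-picked (allFin R)))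
      (trans (mean-fromℕ (size ∘ lookup (subsets (4 + m))) ℚ.1ℚ (allFin R))
        (cong (ℚ._* 1/R) (trans (ℚₚ.*-identityʳ _) (cong fromℕ total))))

theorem1 : Σ[ δ ∈ ℚ ] (0ℚ ℚ.< δ × (Σ[ A ∈ OnlineAlgorithm ] ((½ ℚ.+ δ) -competitive A)))
theorem1 = ℤ.+ 1 ℚ./ 384 , from-yes (0ℚ ℚ.<? ℤ.+ 1 ℚ./ 384) , mixture-algorithm ,
  λ {m} M₁ M₂ OPT (OPT∈I , _) → subst (((½ ℚ.+ ℤ.+ 1 ℚ./ 384) ℚ.* fromℕ ∣ OPT ∣) ℚ.≤_)
    (sym (expectedSize-mixture M₁ M₂))
    (fraction-≤ ∣ OPT ∣ (total-size M₁ M₂) (2 ^ (4 + m)) (m !) ⦃ m^n≢0 2 (4 + m) ⦄ ⦃ m !≢0 ⦄ (mixture-bound M₁ M₂ OPT∈I))
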